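{- For all integers $n,r\ge 2$, $$|B_x(n,r)|\ \le\ 1+2\sum_{i=1}^{r-1}\binom{n}{i}\binom{r+2^i-1}{r}\Big/ i!\;+\;2\binom{n}{r}\binom{r+2^r}{r+1}\Big/ r!\;+\;2\sum_{i=r+1}^{n}\binom{n}{i}\binom{i+2^r-1}{i}\Big/ r!,$$ where $\binom{a}{b}=0$ when $b>a$ and empty sums are $0$.
   Context: Let $I$ (left vertices) and $O$ (right vertices) be disjoint finite sets with $|I|=n$ and $|O|=r$. An $(n,r)$-bipartite graph is $G=(I\oplus O,E)$ with edge set $E\subseteq I\times O$. The connected domain $I_c(G)$ is the set of vertices of $I$ with nonzero degree in $G$. Two $(n,r)$-bipartite graphs $G_1=(I\oplus O,E_1)$ and $G_2=(I\oplus O,E_2)$ are left-set-labeled equivalent if there exist bijections $\alpha:I\to I$ and $\beta:O\to O$ such that for all $x\in I,y\in O$, $(x,y)\in E_1$ iff $(\alpha(x),\beta(y))\in E_2$, and moreover $I_c(G_1)=I_c(G_2)$. $B_x(n,r)$ denotes the set of equivalence classes of $(n,r)$-bipartite graphs under left-set-labeled equivalence. -}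

module Defs where

open import Data.Nat using (ℕ; zero; suc; _+_; _*_; _∸_; _^_; _!)
open import Data.Nat.Properties using (_!≢0)
open import Data.Nat.Combinatorics using (_C_)
open import Data.Integer using (+_)
open import Data.Rational using (ℚ; _/_) renaming (_+_ to _+ℚ_; 0ℚ to 0q)
open import Data.Bool using (Bool; true)
open import Data.Fin using (Fin)
open import Data.Fin.Permutation using (Permutation′; _⟨$⟩ʳ_)
open import Data.List using (List; length; lookup)
open import Data.Product using (Σ; ∃; _×_)
open import Relation.Binary.PropositionalEquality using (_≡_)
open import Function.Bundles using (_⇔_)

-- An (n,r)-bipartite graph with I = Fin n (left), O = Fin r (right):
-- its edge set E ⊆ I × O given by its characteristic function.
BipGraph : ℕ → ℕ → Set
BipGraph n r = Fin n → Fin r → Bool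

InConnDomain : ∀ {n r} → BipGraph n r → Fin n → Set
InConnDomain {n} {r} G x = ∃ λ (y : Fin r) → G x y ≡ true

LSLEquiv : ∀ {n r} → BipGraph n r → BipGraph n r → Set
LSLEquiv {n} {r} G₁ G₂ =
  (Σ (Permutation′ n) λ α → Σ (Permutation′ r) λ β →
     ∀ (x : Fin n) (y : Fin r) → (G₁ x y ≡ true) ⇔ (G₂ (α ⟨$⟩ʳ x) (β ⟨$⟩ʳ y) ≡ true))
  × (∀ (x : Fin n) → InConnDomain G₁ x ⇔ InConnDomain G₂ x)

-- A complete system of representatives of B_x(n,r), given as a list:
-- every graph is equivalent to some entry, and distinct entries are
-- inequivalent. Its length is |B_x(n,r)|.
IsClassRepList : ∀ {n r} → List (BipGraph n r) → Set
IsClassRepList {n} {r} L =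
  (∀ (G : BipGraph n r) → ∃ λ (i : Fin (length L)) → LSLEquiv G (lookup L i))
  × (∀ (i j : Fin (length L)) → LSLEquiv (lookup L i) (lookup L j) → i ≡ j)

sumFromTo : ℕ → ℕ → (ℕ → ℚ) → ℚ
sumFromTo a b f = go (suc b ∸ a)
  where
  go : ℕ → ℚ
  go zero = 0q
  go (suc k) = f (a + k) +ℚ go k

divFact : ℕ → ℕ → ℚ
divFact a k = (+ a) / (k !)
  where instance _ = k !≢0

bound : ℕ → ℕ → ℚ
bound n r =
  ((+ 1) / 1)
  +ℚ (sumFromTo 1 (r ∸ 1) (λ i → divFact (2 * ((n C i) * ((r + 2 ^ i ∸ 1) C r))) i))
  +ℚ divFact (2 * ((n C r) * ((r + 2 ^ r) C (r + 1)))) r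
  +ℚ (sumFromTo (r + 1) n (λ i → divFact (2 * ((n C i) * ((i + 2 ^ r ∸ 1) C i))) r))

{-# OPTIONS --safe #-}
module Submission where

-- Classify the graphs by their connected domain S.  For |S| = i the classes are the orbits of
-- Sym(i) × Sym(r) on i × r Boolean matrices without zero rows, so Burnside bounds their number
-- by 1/(i! r!) times the sum over σ ∈ Sym(i) of the number of pairs (π , f), f assigning to each
-- of r columns a point of X = {0,1}^i, with f ∘ π = σ ∘ f.  With q = 2^i and p = 2^c(σ), where
-- c(σ) is the number of cycles, a fixed point of π leaves at most p choices for its value and any
-- other cycle at most q, so the number of pairs is at most the weight B(r) given by
--   B(r + 1) = (p + r) B(r) + r (q − p) B(r − 1).
-- For σ = id this is q (q + 1) ⋯ (q + r − 1) = r! C(r + q − 1 , r), and it remains to see that for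
-- r > i all other σ together contribute at most as much again.  Since B(r + 1) ≤ (q + r) B(r), only
-- r = i + 1 matters.  For i < 34 the sum is evaluated with Stirling numbers.  For i ≥ 34 one has
-- B(r) ≤ (4/5)^((i − c) r) q ⋯ (q + r − 1), and with z = (4/5)^r the sum over σ of z^(i − c(σ)) is
-- the product of the 1 + j z for j < i, which is at most 2 because 2 i² z ≤ 1.
-- The case i > r is the transpose of i < r, and i = r follows from (r + 1) B(r) ≤ B(r + 1).

open import Defs
open import Data.Bool using (Bool; true; false; _∧_)
import Data.Bool as Bool
import Data.Bool.Properties as Bool
open import Data.Fin using (Fin; zero; suc)
import Data.Fin.Properties as Fin
open import Data.List using (List; []; _∷_; _++_; map; length; cartesianProductWith) renaming (lookup to lookupᴸ)
open import Data.Product using (∃; _×_; _,_; proj₁; proj₂)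
open import Data.Sum using (_⊎_; inj₁; inj₂)
open import Function using (_∘_; flip)
open import Relation.Binary.PropositionalEquality using (_≡_; _≢_; _≗_; refl; sym; trans; cong; cong₂; subst; module ≡-Reasoning)

module OrbitCounting where

  open import Data.Fin.Permutation using (Permutation′; permutation; _⟨$⟩ʳ_; _⟨$⟩ˡ_; _∘ₚ_; transpose; lift₀; remove; lift₀-remove; lift₀-cong; inverseˡ; inverseʳ) renaming (id to idₚ; flip to flipₚ)
  open import Data.Fin.Permutation.Components using (transpose-inverse)
  open import Data.Nat using (ℕ; zero; suc; pred; _+_; _*_; _^_; _∸_; _!; _/_; _≤_; _<_; _≤ᵇ_; z≤n; s≤s; NonZero; >-nonZero)
  open import Data.Nat.Combinatorics using (_C_; nCk≡n!/k![n-k]!; k![n∸k]!∣n!; nCk+nC[k+1]≡[n+1]C[k+1]; k>n⇒nCk≡0)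
  open import Data.Nat.DivMod using (m/n*n≡m; m/n*n≤m; /-monoˡ-≤; m*n/n≡m)
  open import Data.Nat.Properties hiding (_≟_)
  open import Data.Nat.Tactic.RingSolver using (solve-∀)
  import Data.Product.Properties as Prod
  open import Data.Unit using (⊤; tt)
  import Data.Unit.Properties as Unit
  open import Data.Vec using (Vec; []; _∷_; lookup; tabulate; replicate; _[_]≔_)
  import Data.Vec.Properties as Vec
  open import Function.Bundles using (_⇔_; mk⇔; Equivalence)
  open import Relation.Binary using (DecidableEquality; tri<; tri≈; tri>)
  open import Relation.Nullary using (Dec; yes; no; does; contradiction)
  open import Relation.Nullary.Decidable using (dec-true; dec-false)

  -- Finite sums and finite types

  private variable
    A A′ A″ : Set

  *-shuffle : ∀ a b c → a * (b * c) ≡ b * (a * c)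
  *-shuffle = solve-∀

  +-interchange : ∀ a b c d → a + b + (c + d) ≡ a + c + (b + d)
  +-interchange = solve-∀

  ∑ : List A → (A → ℕ) → ℕ
  ∑ []       f = 0
  ∑ (x ∷ xs) f = f x + ∑ xs f

  ∑-mono : ∀ (xs : List A) {f g} → (∀ x → f x ≤ g x) → ∑ xs f ≤ ∑ xs g
  ∑-mono []       f≤g = z≤n
  ∑-mono (x ∷ xs) f≤g = +-mono-≤ (f≤g x) (∑-mono xs f≤g)

  ∑-cong : ∀ (xs : List A) {f g} → (∀ x → f x ≡ g x) → ∑ xs f ≡ ∑ xs g
  ∑-cong []       f≡g = refl
  ∑-cong (x ∷ xs) f≡g = cong₂ _+_ (f≡g x) (∑-cong xs f≡g)

  ∑-zero : ∀ (xs : List A) → ∑ xs (λ _ → 0) ≡ 0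
  ∑-zero []       = refl
  ∑-zero (x ∷ xs) = ∑-zero xs

  ∑-const : ∀ (xs : List A) c → ∑ xs (λ _ → c) ≡ length xs * c
  ∑-const []       c = refl
  ∑-const (x ∷ xs) c = cong (c +_) (∑-const xs c)

  ∑-+ : ∀ (xs : List A) f g → ∑ xs (λ x → f x + g x) ≡ ∑ xs f + ∑ xs g
  ∑-+ []       f g = refl
  ∑-+ (x ∷ xs) f g rewrite ∑-+ xs f g = +-interchange (f x) (g x) (∑ xs f) (∑ xs g)

  ∑-*ˡ : ∀ (xs : List A) c f → ∑ xs (λ x → c * f x) ≡ c * ∑ xs f
  ∑-*ˡ []       c f = sym (*-zeroʳ c)
  ∑-*ˡ (x ∷ xs) c f rewrite ∑-*ˡ xs c f = sym (*-distribˡ-+ c (f x) (∑ xs f))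

  ∑-*ʳ : ∀ (xs : List A) c f → ∑ xs (λ x → f x * c) ≡ ∑ xs f * c
  ∑-*ʳ []       c f = refl
  ∑-*ʳ (x ∷ xs) c f rewrite ∑-*ʳ xs c f = sym (*-distribʳ-+ c (f x) (∑ xs f))

  ∑-swap : ∀ (xs : List A) (ys : List A′) (f : A → A′ → ℕ) →
           ∑ xs (λ x → ∑ ys (f x)) ≡ ∑ ys (λ y → ∑ xs (λ x → f x y))
  ∑-swap []       ys f = sym (∑-zero ys)
  ∑-swap (x ∷ xs) ys f rewrite ∑-swap xs ys f = sym (∑-+ ys (f x) _)

  ∑-++ : ∀ (xs ys : List A) f → ∑ (xs ++ ys) f ≡ ∑ xs f + ∑ ys f
  ∑-++ []       ys f = refl
  ∑-++ (x ∷ xs) ys f rewrite ∑-++ xs ys f = sym (+-assoc (f x) _ _)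

  ∑-map : ∀ (h : A → A′) xs f → ∑ (map h xs) f ≡ ∑ xs (λ x → f (h x))
  ∑-map h []       f = refl
  ∑-map h (x ∷ xs) f = cong (f (h x) +_) (∑-map h xs f)

  ∑-cartesian : ∀ (h : A → A′ → A″) xs ys f →
                ∑ (cartesianProductWith h xs ys) f ≡ ∑ xs (λ x → ∑ ys (λ y → f (h x y)))
  ∑-cartesian h []       ys f = refl
  ∑-cartesian h (x ∷ xs) ys f
    rewrite ∑-++ (map (h x) ys) (cartesianProductWith h xs ys) f
          | ∑-map (h x) ys f | ∑-cartesian h xs ys f = refl

  ∑-positive : ∀ (xs : List A) f → 0 < ∑ xs f → ∃ λ x → 0 < f x
  ∑-positive (x ∷ xs) f 0<∑ with f x in eq
  ... | suc k = x , subst (0 <_) (sym eq) (s≤s z≤n)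
  ... | zero  = ∑-positive xs f 0<∑

  ind : Dec A → ℕ
  ind (yes _) = 1
  ind (no _)  = 0

  ind-yes : ∀ (a? : Dec A) → A → ind a? ≡ 1
  ind-yes (yes _) _ = refl
  ind-yes (no ¬a) a = contradiction a ¬a

  ind-mono : ∀ (a? : Dec A) (b? : Dec A′) → (A → A′) → ind a? ≤ ind b?
  ind-mono (no _)  b? f = z≤n
  ind-mono (yes a) b? f = ≤-reflexive (sym (ind-yes b? (f a)))

  ind-witness : ∀ (a? : Dec A) → 0 < ind a? → A
  ind-witness (yes a) _ = a

  ind-≤1 : ∀ (a? : Dec A) → ind a? ≤ 1
  ind-≤1 (yes _) = ≤-refl
  ind-≤1 (no _)  = z≤n

  ind-× : ∀ (c? : Dec A″) (a? : Dec A) (b? : Dec A′) → (A″ → A × A′) → ind c? ≤ ind a? * ind b?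
  ind-× (no _)  a? b? f = z≤n
  ind-× (yes c) a? b? f
    rewrite ind-yes a? (proj₁ (f c)) | ind-yes b? (proj₂ (f c)) = ≤-refl

  -- Completeness and absence of repetition are packed into the single equation `once`, so that a
  -- sum against the indicator of a point collapses to one value (`∑-delta`).
  record Finite (A : Set) : Set where
    field
      elems : List A
      _≟_   : DecidableEquality A
      once  : ∀ c → ∑ elems (λ x → ind (x ≟ c)) ≡ 1

    ∑-delta : ∀ c f → ∑ elems (λ x → ind (x ≟ c) * f x) ≡ f c
    ∑-delta c f = trans (∑-cong elems pointwise)
                  (trans (∑-*ʳ elems (f c) _) (trans (cong (_* f c) (once c)) (*-identityˡ (f c))))
      where
      pointwise : ∀ x → ind (x ≟ c) * f x ≡ ind (x ≟ c) * f c
      pointwise x with x ≟ c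
      ... | yes refl = refl
      ... | no _     = refl

    ∑-≥ : ∀ c f → f c ≤ ∑ elems f
    ∑-≥ c f = ≤-trans (≤-reflexive (sym (∑-delta c f))) (∑-mono elems pointwise)
      where
      pointwise : ∀ x → ind (x ≟ c) * f x ≤ f x
      pointwise x = ≤-trans (*-monoˡ-≤ (f x) (ind-≤1 (x ≟ c))) (≤-reflexive (*-identityˡ (f x)))

    card : ℕ
    card = length elems

  open Finite public using (elems; card)

  ind-≡ : {P Q : Set} (p? : Dec P) (q? : Dec Q) → (P → Q) → (Q → P) → ind p? ≡ ind q?
  ind-≡ p? q? f g = ≤-antisym (ind-mono p? q? f) (ind-mono q? p? g)

  fins : ∀ n → List (Fin n)
  fins zero    = []
  fins (suc n) = zero ∷ map suc (fins n)

  ∑-fins-suc : ∀ n f → ∑ (fins (suc n)) f ≡ f zero + ∑ (fins n) (λ j → f (suc j))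
  ∑-fins-suc n f = cong (f zero +_) (∑-map suc (fins n) f)

  ∑-fins-const : ∀ n c → ∑ (fins n) (λ _ → c) ≡ n * c
  ∑-fins-const zero    c = refl
  ∑-fins-const (suc n) c = trans (∑-fins-suc n _) (cong (c +_) (∑-fins-const n c))

  finFin : ∀ n → Finite (Fin n)
  finFin n = record { elems = fins n ; _≟_ = Fin._≟_ ; once = onceFin n }
    where
    onceFin : ∀ n c → ∑ (fins n) (λ x → ind (x Fin.≟ c)) ≡ 1
    onceFin (suc n) zero =
      cong suc (trans (∑-map suc (fins n) _) (∑-zero (fins n)))
    onceFin (suc n) (suc c) =
      trans (∑-map suc (fins n) _)
        (trans (∑-cong (fins n) λ x → ind-≡ (suc x Fin.≟ suc c) (x Fin.≟ c) Fin.suc-injective (cong suc))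
               (onceFin n c))

  finBool : Finite Bool
  finBool = record
    { elems = false ∷ true ∷ [] ; _≟_ = Bool._≟_
    ; once = λ { false → refl ; true → refl } }

  -- The pairing `h` stays abstract because one proof then serves both `_,_` and `_∷_`.
  module _ (h : A → A′ → A″) (h-inj : ∀ {a b a′ b′} → h a b ≡ h a′ b′ → a ≡ a′ × b ≡ b′)
           (split : ∀ c → ∃ λ a → ∃ λ b → h a b ≡ c) (_≟ᶜ_ : DecidableEquality A″)
           (FA : Finite A) (FB : Finite A′) where
    private
      module FA = Finite FA
      module FB = Finite FB

    finPair : Finite A″
    finPair = record
      { elems = cartesianProductWith h (elems FA) (elems FB) ; _≟_ = _≟ᶜ_ ; once = oncePair }
      where
      factor : ∀ x y a b → ind (h x y ≟ᶜ h a b) ≡ ind (x FA.≟ a) * ind (y FB.≟ b)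
      factor x y a b = ≤-antisym
        (ind-× (h x y ≟ᶜ h a b) (x FA.≟ a) (y FB.≟ b) h-inj)
        (backward (x FA.≟ a) (y FB.≟ b))
        where
        backward : ∀ (p? : Dec (x ≡ a)) (q? : Dec (y ≡ b)) → ind p? * ind q? ≤ ind (h x y ≟ᶜ h a b)
        backward (no _)     q?         = z≤n
        backward (yes _)    (no _)     = z≤n
        backward (yes refl) (yes refl) = ≤-reflexive (sym (ind-yes (h x y ≟ᶜ h x y) refl))

      oncePair : ∀ c → ∑ (cartesianProductWith h (elems FA) (elems FB)) (λ x → ind (x ≟ᶜ c)) ≡ 1
      oncePair c with split c
      ... | a , b , refl =
        trans (∑-cartesian h (elems FA) (elems FB) _)
        (trans (∑-cong (elems FA) λ x →
                  trans (∑-cong (elems FB) λ y → factor x y a b)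
                  (trans (∑-*ˡ (elems FB) (ind (x FA.≟ a)) _)
                  (trans (cong (ind (x FA.≟ a) *_) (FB.once b)) (*-identityʳ _))))
               (FA.once a))

  finProd : Finite A → Finite A′ → Finite (A × A′)
  finProd FA FB = finPair _,_ (λ { refl → refl , refl }) (λ (a , b) → a , b , refl)
                          (Prod.≡-dec (Finite._≟_ FA) (Finite._≟_ FB)) FA FB

  finVec : Finite A → ∀ n → Finite (Vec A n)
  finVec FA zero = record
    { elems = [] ∷ [] ; _≟_ = Vec.≡-dec (Finite._≟_ FA) ; once = λ { [] → refl } }
  finVec FA (suc n) = finPair _∷_ Vec.∷-injective (λ { (a ∷ v) → a , v , refl })
                              (Vec.≡-dec (Finite._≟_ FA)) FA (finVec FA n)

  -- The left inverse `ψ` makes `φ` injective: only `ψ b` can be sent to `b`. An injection carrying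
  -- `P` into `Q` cannot lower the count.
  ∑-reindex : (FA : Finite A) (FB : Finite A′) (φ : A → A′) (ψ : A′ → A) → (∀ a → ψ (φ a) ≡ a) →
              {P : A → Set} {Q : A′ → Set} (P? : ∀ a → Dec (P a)) (Q? : ∀ b → Dec (Q b)) →
              (∀ a → P a → Q (φ a)) →
              ∑ (elems FA) (λ a → ind (P? a)) ≤ ∑ (elems FB) (λ b → ind (Q? b))
  ∑-reindex FA FB φ ψ ψφ P? Q? P⇒Q = begin
    ∑ (elems FA) (λ a → ind (P? a))
      ≤⟨ ∑-mono (elems FA) (λ a → ind-mono (P? a) (Q? (φ a)) (P⇒Q a)) ⟩
    ∑ (elems FA) (λ a → ind (Q? (φ a)))
      ≡⟨ ∑-cong (elems FA) (λ a → sym (FB.∑-delta (φ a) (λ b → ind (Q? b)))) ⟩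
    ∑ (elems FA) (λ a → ∑ (elems FB) (λ b → ind (b FB.≟ φ a) * ind (Q? b)))
      ≡⟨ ∑-swap (elems FA) (elems FB) _ ⟩
    ∑ (elems FB) (λ b → ∑ (elems FA) (λ a → ind (b FB.≟ φ a) * ind (Q? b)))
      ≡⟨ ∑-cong (elems FB) (λ b → ∑-*ʳ (elems FA) (ind (Q? b)) _) ⟩
    ∑ (elems FB) (λ b → ∑ (elems FA) (λ a → ind (b FB.≟ φ a)) * ind (Q? b))
      ≤⟨ ∑-mono (elems FB) (λ b → *-monoˡ-≤ (ind (Q? b)) (fibre≤1 b)) ⟩
    ∑ (elems FB) (λ b → 1 * ind (Q? b))
      ≡⟨ ∑-cong (elems FB) (λ b → *-identityˡ _) ⟩
    ∑ (elems FB) (λ b → ind (Q? b)) ∎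
    where
    open ≤-Reasoning
    module FA = Finite FA
    module FB = Finite FB
    fibre≤1 : ∀ b → ∑ (elems FA) (λ a → ind (b FB.≟ φ a)) ≤ 1
    fibre≤1 b = ≤-trans
      (∑-mono (elems FA) λ a → ind-mono (b FB.≟ φ a) (a FA.≟ ψ b) λ { refl → sym (ψφ a) })
      (≤-reflexive (FA.once (ψ b)))

  -- If the sum is positive, some index carries a positive term, and by exclusivity it is the only
  -- one.
  ∑-exclusive : (FA : Finite A) (u : A → ℕ) (M : ℕ) → (∀ a → u a ≤ M) →
                (∀ a b → 0 < u a → 0 < u b → a ≡ b) → ∑ (elems FA) u ≤ M
  ∑-exclusive FA u M u≤M excl with ∑ (elems FA) u in eq
  ... | zero  = z≤n
  ... | suc k = subst (_≤ M) eq (begin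
    ∑ (elems FA) u                           ≤⟨ ∑-mono (elems FA) pointwise ⟩
    ∑ (elems FA) (λ a → ind (a FA.≟ a₀) * M) ≡⟨ FA.∑-delta a₀ (λ _ → M) ⟩
    M                                        ∎)
    where
    open ≤-Reasoning
    module FA = Finite FA
    witness = ∑-positive (elems FA) u (subst (0 <_) (sym eq) (s≤s z≤n))
    a₀ = proj₁ witness
    pointwise : ∀ a → u a ≤ ind (a FA.≟ a₀) * M
    pointwise a with a FA.≟ a₀
    ... | yes _    = ≤-trans (u≤M a) (≤-reflexive (sym (*-identityˡ M)))
    ... | no a≢a₀ = ≮⇒≥ (λ 0<u → a≢a₀ (excl a a₀ 0<u (proj₂ witness)))

  -- Permutations coded by cycle insertion

  -- (j , σ) codes the permutation obtained from σ on {1,…,n} by inserting 0 into its cycle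
  -- structure: as a new fixed point if j = 0, and right after j otherwise.
  Code : ℕ → Set
  Code zero    = ⊤
  Code (suc n) = Fin (suc n) × Code n

  finCode : ∀ n → Finite (Code n)
  finCode zero    = record { elems = tt ∷ [] ; _≟_ = Unit._≟_ ; once = λ _ → refl }
  finCode (suc n) = finProd (finFin (suc n)) (finCode n)

  codes : ∀ n → List (Code n)
  codes n = elems (finCode n)

  ∑-codes-suc : ∀ n F → ∑ (codes (suc n)) F ≡
    ∑ (codes n) (λ σ → F (zero , σ)) + ∑ (fins n) (λ j → ∑ (codes n) (λ σ → F (suc j , σ)))
  ∑-codes-suc n F = trans (∑-cartesian _,_ (fins (suc n)) (codes n) F) (∑-fins-suc n _)

  ∑-codes-const : ∀ n c → ∑ (codes n) (λ _ → c) ≡ n ! * c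
  ∑-codes-const zero    c = refl
  ∑-codes-const (suc n) c = trans (∑-codes-suc n _)
    (trans (cong₂ _+_ (∑-codes-const n c)
                      (trans (∑-cong (fins n) λ _ → ∑-codes-const n c) (∑-fins-const n (n ! * c))))
           (sym (*-assoc (suc n) (n !) c)))

  -- `_∘ₚ_` applies its left argument first: `j` goes to `zero` and, if `j` is not `zero`, `zero`
  -- goes to where `σ` sent `j`.
  decode : ∀ n → Code n → Permutation′ n
  decode zero    _       = idₚ
  decode (suc n) (j , σ) = transpose zero j ∘ₚ lift₀ (decode n σ)

  act : ∀ {n} → Code n → Fin n → Fin n
  act {n} σ = decode n σ ⟨$⟩ʳ_

  act-self : ∀ {n} j (σ : Code n) → act {suc n} (j , σ) j ≡ zero
  act-self zero    σ = refl
  act-self (suc j) σ rewrite dec-true (j Fin.≟ j) refl = refl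

  act-other : ∀ {n} j (σ : Code n) k → k ≢ j → act {suc n} (suc j , σ) (suc k) ≡ suc (act σ k)
  act-other j σ k k≢j with k Fin.≟ j
  ... | yes k≡j = contradiction k≡j k≢j
  ... | no _    = refl

  transpose-comm : ∀ {n} (j k : Fin (suc n)) → transpose zero j ⟨$⟩ʳ k ≡ transpose j zero ⟨$⟩ʳ k
  transpose-comm zero    k       = refl
  transpose-comm (suc j) zero    = refl
  transpose-comm (suc j) (suc k) with k Fin.≟ j
  ... | yes _ = refl
  ... | no _  = refl

  -- Inverse to `decode`: `j` is the preimage of `zero`, and transposing `zero` and `j` beforehand
  -- makes `zero` a fixed point, which can be removed.
  encode : ∀ n → Permutation′ n → Code n
  encode zero    π = tt
  encode (suc n) π = π ⟨$⟩ˡ zero , encode n (remove zero (transpose zero (π ⟨$⟩ˡ zero) ∘ₚ π))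

  act-encode : ∀ n π → act (encode n π) ≗ (π ⟨$⟩ʳ_)
  act-encode (suc n) π k = trans (lift₀-cong _ _ (act-encode n (remove zero ρ)) (transpose zero j ⟨$⟩ʳ k))
    (trans (lift₀-remove ρ (inverseʳ π) (transpose zero j ⟨$⟩ʳ k))
           (cong (π ⟨$⟩ʳ_) (involutive k)))
    where
    j = π ⟨$⟩ˡ zero
    ρ = transpose zero j ∘ₚ π
    involutive : ∀ k → transpose zero j ⟨$⟩ʳ (transpose zero j ⟨$⟩ʳ k) ≡ k
    involutive k = trans (cong (transpose zero j ⟨$⟩ʳ_) (transpose-comm j k)) (transpose-inverse zero j)

  -- The first component is recovered as the preimage of `zero`; undoing its transposition leaves
  -- equal actions of the tails. With `act-encode`, codes and permutations correspond one to one.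
  act-injective : ∀ n {σ τ : Code n} → act σ ≗ act τ → σ ≡ τ
  act-injective zero    eq = refl
  act-injective (suc n) {i , σ} {j , τ} eq with injective
    where
    injective : i ≡ j
    injective = trans (sym (inverseˡ (decode (suc n) (j , τ))))
      (trans (cong (decode (suc n) (j , τ) ⟨$⟩ˡ_)
               (trans (sym (eq i)) (trans (act-self i σ) (sym (act-self j τ)))))
             (inverseˡ (decode (suc n) (j , τ))))
  act-injective (suc n) {i , σ} {j , τ} eq | refl = cong (i ,_) (act-injective n λ k → Fin.suc-injective (unlift (suc k)))
    where
    unlift : ∀ k → lift₀ (decode n σ) ⟨$⟩ʳ k ≡ lift₀ (decode n τ) ⟨$⟩ʳ k
    unlift k = subst (λ x → lift₀ (decode n σ) ⟨$⟩ʳ x ≡ lift₀ (decode n τ) ⟨$⟩ʳ x)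
                     (transpose-inverse zero i) (eq (transpose i zero ⟨$⟩ʳ k))

  cycles : ∀ n → Code n → ℕ
  cycles zero    _           = 0
  cycles (suc n) (zero , σ)  = suc (cycles n σ)
  cycles (suc n) (suc j , σ) = cycles n σ

  -- Weighted counts of permutations with light and heavy points

  trues falses : ∀ {n} → Vec Bool n → ℕ
  trues []          = 0
  trues (true ∷ w)  = suc (trues w)
  trues (false ∷ w) = trues w
  falses []          = 0
  falses (true ∷ w)  = falses w
  falses (false ∷ w) = suc (falses w)

  -- Darkening a `true` entry moves it to the other count; darkening a `false` entry changes
  -- nothing. The value of `pred` at 0 is harmless, being multiplied by 0.
  ∑-darken : ∀ {n} (w : Vec Bool n) (F : ℕ → ℕ → ℕ) →
    ∑ (fins n) (λ j → F (trues (w [ j ]≔ false)) (falses (w [ j ]≔ false)))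
      ≡ trues w * F (pred (trues w)) (suc (falses w)) + falses w * F (trues w) (falses w)
  ∑-darken []         F = refl
  ∑-darken {suc n} (true ∷ w) F = trans (∑-fins-suc n _)
    (trans (cong (F (trues w) (suc (falses w)) +_) (∑-darken w (λ s → F (suc s))))
    (trans (sym (+-assoc (F (trues w) (suc (falses w))) _ _))
           (cong (_+ falses w * F (suc (trues w)) (falses w)) (absorb (trues w)))))
    where
    absorb : ∀ s → F s (suc (falses w)) + s * F (suc (pred s)) (suc (falses w))
                 ≡ F s (suc (falses w)) + s * F s (suc (falses w))
    absorb zero    = refl
    absorb (suc s) = refl
  ∑-darken {suc n} (false ∷ w) F = trans (∑-fins-suc n _)
    (trans (cong (F (trues w) (suc (falses w)) +_) (∑-darken w (λ s t → F s (suc t))))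
           (rearrange (F (trues w) (suc (falses w))) (trues w * F (pred (trues w)) (suc (suc (falses w)))) _))
    where
    rearrange : ∀ a b c → a + (b + c) ≡ b + (a + c)
    rearrange = solve-∀

  module Weights (p δ : ℕ) where

    -- B s sums p ^ (fixed points) * (p + δ) ^ (other cycles) over the permutations of s points;
    -- e s t does so for s + t points, the last t of which weigh p + δ even when fixed.
    B : ℕ → ℕ
    B zero          = 1
    B (suc zero)    = p
    B (suc (suc s)) = (p + suc s) * B (suc s) + suc s * (δ * B s)

    e : ℕ → ℕ → ℕ
    e s zero    = B s
    e s (suc t) = e (suc s) t + δ * e s t

    -- Sorts the permutations by the position of one light point. Fixed, it weighs `p`. Otherwise it
    -- follows another point, and deleting it makes that point heavy, because a fixed point left
    -- behind then stands for a longer cycle.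
    e-light : ∀ s t → e (suc s) t ≡ p * e s t + (s * e (pred s) (suc t) + t * e s t)
    e-light zero    zero    = sym (trans (+-identityʳ (p * 1)) (*-identityʳ p))
    e-light (suc s) zero    = identity p δ s (B (suc s)) (B s)
      where
      identity : ∀ p δ s a b → (p + suc s) * a + suc s * (δ * b)
                 ≡ p * a + (suc s * (a + δ * b) + 0)
      identity = solve-∀
    e-light zero    (suc t) rewrite e-light 1 t | e-light 0 t = identity p δ t (e 0 t)
      where
      identity : ∀ p δ t x →
        p * (p * x + (0 + t * x)) + (1 * (p * x + (0 + t * x) + δ * x) + t * (p * x + (0 + t * x))) + δ * (p * x + (0 + t * x))
        ≡ p * (p * x + (0 + t * x) + δ * x) + (0 + suc t * (p * x + (0 + t * x) + δ * x))
      identity = solve-∀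
    e-light (suc s) (suc t) = begin
      e (suc (suc (suc s))) t + δ * e (suc (suc s)) t
        ≡⟨ cong₂ (λ x y → x + δ * y) (e-light (suc (suc s)) t) (e-light (suc s) t) ⟩
      (p * x + (suc (suc s) * (x + δ * y) + t * x)) + δ * (p * y + (suc s * (y + δ * z) + t * y))
        ≡⟨ identity p δ s t x y z ⟩
      p * (x + δ * y) + (suc s * ((x + δ * y) + δ * (y + δ * z)) + suc t * (x + δ * y)) ∎
      where
      open ≡-Reasoning
      x = e (suc (suc s)) t
      y = e (suc s) t
      z = e s t
      identity : ∀ p δ s t x y z →
        (p * x + (suc (suc s) * (x + δ * y) + t * x)) + δ * (p * y + (suc s * (y + δ * z) + t * y))
        ≡ p * (x + δ * y) + (suc s * ((x + δ * y) + δ * (y + δ * z)) + suc t * (x + δ * y))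
      identity = solve-∀

    e-heavy : ∀ s t → e s (suc t) ≡ (p + δ) * e s t + (s * e (pred s) (suc t) + t * e s t)
    e-heavy s t rewrite e-light s t = identity p δ (e s t) _
      where
      identity : ∀ p δ x y → p * x + y + δ * x ≡ (p + δ) * x + y
      identity = solve-∀

  -- Maps that intertwine a permutation with a family of twists

  module Twisted {X : Set} (FX : Finite X) where
    open Finite FX using (_≟_; once)

    vecs : ∀ n → List (Vec X n)
    vecs n = elems (finVec FX n)

    Intertwines : ∀ {n} → Code n → (Fin n → X → X) → Vec X n → Set
    Intertwines π g f = ∀ y → lookup f (act π y) ≡ g y (lookup f y)

    intertwines? : ∀ {n} (π : Code n) g f → Dec (Intertwines π g f)
    intertwines? π g f = Fin.all? (λ y → lookup f (act π y) ≟ g y (lookup f y))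

    pairs : ∀ {n} → (Fin n → X → X) → ℕ
    pairs {n} g = ∑ (codes n) λ π → ∑ (vecs n) λ f → ind (intertwines? π g f)

    fixed : (X → X) → ℕ
    fixed h = ∑ (elems FX) λ x → ind (h x ≟ x)

    ∑-vecs-suc : ∀ n F → ∑ (vecs (suc n)) F ≡ ∑ (elems FX) (λ x → ∑ (vecs n) (λ f → F (x ∷ f)))
    ∑-vecs-suc n F = ∑-cartesian _∷_ (elems FX) (vecs n) F

    fixed-0-bound : ∀ {n} (g : Fin (suc n) → X → X) (π : Code n) →
      ∑ (vecs (suc n)) (λ f → ind (intertwines? (zero , π) g f))
      ≤ fixed (g zero) * ∑ (vecs n) (λ f → ind (intertwines? π (λ y → g (suc y)) f))
    fixed-0-bound {n} g π = begin
      ∑ (vecs (suc n)) (λ f → ind (intertwines? (zero , π) g f))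
        ≡⟨ ∑-vecs-suc n _ ⟩
      ∑ (elems FX) (λ x → ∑ (vecs n) (λ f → ind (intertwines? (zero , π) g (x ∷ f))))
        ≤⟨ ∑-mono (elems FX) (λ x → ∑-mono (vecs n) λ f →
             ind-× (intertwines? (zero , π) g (x ∷ f)) (g zero x ≟ x) (intertwines? π g′ f)
                   (λ sat → sym (sat zero) , λ y → sat (suc y))) ⟩
      ∑ (elems FX) (λ x → ∑ (vecs n) (λ f → ind (g zero x ≟ x) * ind (intertwines? π g′ f)))
        ≡⟨ ∑-cong (elems FX) (λ x → ∑-*ˡ (vecs n) (ind (g zero x ≟ x)) (λ f → ind (intertwines? π g′ f))) ⟩
      ∑ (elems FX) (λ x → ind (g zero x ≟ x) * ∑ (vecs n) (λ f → ind (intertwines? π g′ f)))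
        ≡⟨ ∑-*ʳ (elems FX) (∑ (vecs n) (λ f → ind (intertwines? π g′ f))) (λ x → ind (g zero x ≟ x)) ⟩
      fixed (g zero) * ∑ (vecs n) (λ f → ind (intertwines? π (λ y → g (suc y)) f)) ∎
      where
      open ≤-Reasoning
      g′ = λ y → g (suc y)

    -- Deleting 0 from the cycle of j composes the two twists; this is why the twists
    -- have to be allowed to vary with the index.
    contract : ∀ {n} → (Fin (suc n) → X → X) → Fin n → Fin n → X → X
    contract g j k with k Fin.≟ j
    ... | yes _ = λ x → g zero (g (suc j) x)
    ... | no _  = g (suc k)

    -- The code sends `suc j` to `zero`, so the value at `zero` is forced by the value at `suc j`;
    -- substituting it leaves the contracted problem on the other points.
    moved-0-bound : ∀ {n} (g : Fin (suc n) → X → X) j (π : Code n) →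
      ∑ (vecs (suc n)) (λ f → ind (intertwines? (suc j , π) g f))
      ≤ ∑ (vecs n) (λ f → ind (intertwines? π (contract g j) f))
    moved-0-bound {n} g j π = begin
      ∑ (vecs (suc n)) (λ f → ind (intertwines? (suc j , π) g f))
        ≡⟨ ∑-vecs-suc n _ ⟩
      ∑ (elems FX) (λ x → ∑ (vecs n) (λ f → ind (intertwines? (suc j , π) g (x ∷ f))))
        ≤⟨ ∑-mono (elems FX) (λ x → ∑-mono (vecs n) λ f →
             ind-× (intertwines? (suc j , π) g (x ∷ f)) (x ≟ g (suc j) (lookup f j))
                   (intertwines? π (contract g j) f) (λ sat → determined x f sat , reduced x f sat)) ⟩
      ∑ (elems FX) (λ x → ∑ (vecs n) (λ f →
        ind (x ≟ g (suc j) (lookup f j)) * ind (intertwines? π (contract g j) f)))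
        ≡⟨ ∑-swap (elems FX) (vecs n) _ ⟩
      ∑ (vecs n) (λ f → ∑ (elems FX) (λ x →
        ind (x ≟ g (suc j) (lookup f j)) * ind (intertwines? π (contract g j) f)))
        ≡⟨ ∑-cong (vecs n) (λ f → Finite.∑-delta FX (g (suc j) (lookup f j)) _) ⟩
      ∑ (vecs n) (λ f → ind (intertwines? π (contract g j) f)) ∎
      where
      open ≤-Reasoning
      determined : ∀ x f → Intertwines (suc j , π) g (x ∷ f) → x ≡ g (suc j) (lookup f j)
      determined x f sat = trans (sym (cong (lookup (x ∷ f)) (act-self (suc j) π))) (sat (suc j))

      reduced : ∀ x f → Intertwines (suc j , π) g (x ∷ f) → Intertwines π (contract g j) f
      reduced x f sat k with k Fin.≟ j
      ... | yes refl = trans (sat zero) (cong (g zero) (determined x f sat))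
      ... | no k≢j   = trans (sym (cong (lookup (x ∷ f)) (act-other j π k k≢j))) (sat (suc k))

    module _ (p δ : ℕ) (card≤ : card FX ≤ p + δ) where
      open Weights p δ

      -- `w` marks with `true` the twists known to have at most `p` fixed points. For a composite
      -- made by `contract` only the size of `X` is available as a bound, so `j` loses its mark.
      -- Deleting `zero` thus follows `e-light` or `e-heavy`.
      pairs-bound : ∀ {n} (w : Vec Bool n) (g : Fin n → X → X) →
        (∀ y → lookup w y ≡ true → fixed (g y) ≤ p) → pairs g ≤ e (trues w) (falses w)
      pairs-bound {zero} [] g light = ≤-trans (+-monoˡ-≤ 0 (+-monoˡ-≤ 0 (ind-≤1 (intertwines? {zero} tt g [])))) ≤-refl
      pairs-bound {suc n} (b ∷ w) g light = begin
        pairs g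
          ≡⟨ ∑-codes-suc n _ ⟩
        ∑ (codes n) (λ π → ∑ (vecs (suc n)) (λ f → ind (intertwines? (zero , π) g f)))
        + ∑ (fins n) (λ j → ∑ (codes n) (λ π → ∑ (vecs (suc n)) (λ f → ind (intertwines? (suc j , π) g f))))
          ≤⟨ +-mono-≤ (∑-mono (codes n) (fixed-0-bound g))
                      (∑-mono (fins n) λ j → ∑-mono (codes n) (moved-0-bound g j)) ⟩
        ∑ (codes n) (λ π → fixed (g zero) * ∑ (vecs n) (λ f → ind (intertwines? π (λ y → g (suc y)) f)))
        + ∑ (fins n) (λ j → pairs (contract g j))
          ≡⟨ cong (_+ ∑ (fins n) (λ j → pairs (contract g j))) (∑-*ˡ (codes n) (fixed (g zero)) _) ⟩
        fixed (g zero) * pairs (λ y → g (suc y)) + ∑ (fins n) (λ j → pairs (contract g j))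
          ≤⟨ +-mono-≤ (*-monoʳ-≤ (fixed (g zero)) (pairs-bound w (λ y → g (suc y)) (λ y → light (suc y))))
                      (∑-mono (fins n) λ j → pairs-bound (w [ j ]≔ false) (contract g j) (contract-light j)) ⟩
        fixed (g zero) * e s t + ∑ (fins n) (λ j → e (trues (w [ j ]≔ false)) (falses (w [ j ]≔ false)))
          ≡⟨ cong (fixed (g zero) * e s t +_) (∑-darken w e) ⟩
        fixed (g zero) * e s t + (s * e (pred s) (suc t) + t * e s t)
          ≤⟨ first b (light zero) ⟩
        e (trues (b ∷ w)) (falses (b ∷ w)) ∎
        where
        open ≤-Reasoning
        s = trues w
        t = falses w

        contract-light : ∀ j y → lookup (w [ j ]≔ false) y ≡ true → fixed (contract g j y) ≤ p
        contract-light j y eq with y Fin.≟ j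
        ... | yes refl = contradiction (trans (sym (Vec.lookup∘updateAt y w)) eq) λ ()
        ... | no y≢j   = light (suc y) (trans (sym (Vec.lookup∘updateAt′ y j y≢j w)) eq)

        fixed≤card : ∀ h → fixed h ≤ p + δ
        fixed≤card h = ≤-trans (∑-mono (elems FX) (λ x → ind-≤1 (h x ≟ x)))
          (≤-trans (≤-reflexive (trans (∑-const (elems FX) 1) (*-identityʳ _))) card≤)

        first : ∀ b → (b ≡ true → fixed (g zero) ≤ p) →
          fixed (g zero) * e s t + (s * e (pred s) (suc t) + t * e s t)
          ≤ e (trues (b ∷ w)) (falses (b ∷ w))
        first true  fix≤ = ≤-trans (+-monoˡ-≤ _ (*-monoˡ-≤ (e s t) (fix≤ refl))) (≤-reflexive (sym (e-light s t)))
        first false _    = ≤-trans (+-monoˡ-≤ _ (*-monoˡ-≤ (e s t) (fixed≤card _))) (≤-reflexive (sym (e-heavy s t)))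

      pairs-uniform : ∀ n (h : X → X) → fixed h ≤ p → pairs {n} (λ _ → h) ≤ B n
      pairs-uniform n h fix≤ = ≤-trans (pairs-bound (replicate n true) (λ _ → h) (λ _ _ → fix≤))
        (≤-reflexive (cong₂ e (trues-replicate n) (falses-replicate n)))
        where
        trues-replicate : ∀ n → trues (replicate n true) ≡ n
        trues-replicate zero    = refl
        trues-replicate (suc n) = cong suc (trues-replicate n)
        falses-replicate : ∀ n → falses (replicate n true) ≡ 0
        falses-replicate zero    = refl
        falses-replicate (suc n) = falses-replicate n

    -- Without twists an intertwining vector is constant on cycles: a new fixed point brings a free
    -- value, any other insertion repeats an old one.
    invariant-count : ∀ n (σ : Code n) →
      ∑ (vecs n) (λ v → ind (intertwines? σ (λ _ x → x) v)) ≤ card FX ^ cycles n σ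
    invariant-count zero    σ = ≤-trans (+-monoˡ-≤ 0 (ind-≤1 (intertwines? {zero} tt (λ _ x → x) []))) ≤-refl
    invariant-count (suc n) (zero , σ) = ≤-trans (fixed-0-bound (λ _ x → x) σ)
      (*-mono-≤ (≤-trans (∑-mono (elems FX) λ x → ind-≤1 (x ≟ x))
                         (≤-reflexive (trans (∑-const (elems FX) 1) (*-identityʳ (card FX)))))
                (invariant-count n σ))
    invariant-count (suc n) (suc j , σ) = ≤-trans (moved-0-bound (λ _ x → x) j σ)
      (≤-trans (∑-mono (vecs n) λ v → ind-mono (intertwines? σ (contract (λ _ x → x) j) v) (intertwines? σ (λ _ x → x) v)
                  λ sat k → trans (sat k) (trivial k (lookup v k)))
               (invariant-count n σ))
      where
      trivial : ∀ k x → contract (λ _ x → x) j k x ≡ x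
      trivial k x with k Fin.≟ j
      ... | yes _ = refl
      ... | no _  = refl

  -- Burnside's inequality

  card-finVec : ∀ {A} (FA : Finite A) n → card (finVec FA n) ≡ card FA ^ n
  card-finVec FA n = trans (sym (trans (∑-const (elems (finVec FA n)) 1) (*-identityʳ _))) (∑-one n)
    where
    ∑-one : ∀ n → ∑ (elems (finVec FA n)) (λ _ → 1) ≡ card FA ^ n
    ∑-one zero    = refl
    ∑-one (suc n) = trans (∑-cartesian _∷_ (elems FA) (elems (finVec FA n)) _)
      (trans (∑-cong (elems FA) λ _ → ∑-one n) (∑-const (elems FA) (card FA ^ n)))

  cycles≤n : ∀ n (σ : Code n) → cycles n σ ≤ n
  cycles≤n zero    σ           = z≤n
  cycles≤n (suc n) (zero , σ)  = s≤s (cycles≤n n σ)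
  cycles≤n (suc n) (suc j , σ) = m≤n⇒m≤1+n (cycles≤n n σ)

  -- Bounds the number of pairs (π , f) with f ∘ π = σ ∘ f, where f assigns to each of r columns
  -- a Boolean vector of length i and σ has c cycles on the coordinates.
  fixBound : ℕ → ℕ → ℕ → ℕ
  fixBound i r c = Weights.B (2 ^ c) (2 ^ i ∸ 2 ^ c) r

  module Burnside (i r : ℕ) where
    private
      Column = Vec Bool i
      FColumn = finVec finBool i
      Matrix = Vec Column r
      matrices = elems (finVec FColumn r)
    open Finite FColumn using (_≟_)
    open Twisted FColumn

    permute : Code i → Column → Column
    permute σ x = tabulate (λ k → lookup x (act σ k))

    Maps : Code i × Code r → Matrix → Matrix → Set
    Maps (σ , π) A B = ∀ y → lookup B (act π y) ≡ permute σ (lookup A y)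

    maps? : ∀ h A B → Dec (Maps h A B)
    maps? (σ , π) A B = Fin.all? (λ y → lookup B (act π y) ≟ permute σ (lookup A y))

    maps-entry : ∀ σ π A B → Maps (σ , π) A B → ∀ k y →
                 lookup (lookup B (act π y)) k ≡ lookup (lookup A y) (act σ k)
    maps-entry σ π A B m k y =
      trans (cong (λ v → lookup v k) (m y)) (Vec.lookup∘tabulate (λ k → lookup (lookup A y) (act σ k)) k)

    group = finProd (finCode i) (finCode r)

    transporters : Matrix → Matrix → ℕ
    transporters A B = ∑ (elems group) (λ h → ind (maps? h A B))

    -- Once some `h₀` carries `A` to `B`, undoing `h₀` and then applying `h` turns the transporters
    -- `h` injectively into symmetries of `B`.
    transporters≤stabiliser : ∀ A B → transporters A B ≤ transporters B B
    transporters≤stabiliser A B with transporters A B in eq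
    ... | zero  = z≤n
    ... | suc _ = subst (_≤ transporters B B) eq
      (∑-reindex group group φ ψ ψφ (λ h → maps? h A B) (λ h → maps? h B B) stabilises)
      where
      witness = ∑-positive (elems group) (λ h → ind (maps? h A B)) (subst (0 <_) (sym eq) (s≤s z≤n))
      τ = proj₁ (proj₁ witness)
      ρ = proj₂ (proj₁ witness)
      h₀ : Maps (τ , ρ) A B
      h₀ = ind-witness (maps? (τ , ρ) A B) (proj₂ witness)
      T = decode i τ
      R = decode r ρ

      -- Rows are permuted by precomposition, so the inverse of `T` comes after `σ`, whereas the
      -- inverse of `R` comes before `π`.
      φ ψ : Code i × Code r → Code i × Code r
      φ (σ , π) = encode i (decode i σ ∘ₚ flipₚ T) , encode r (flipₚ R ∘ₚ decode r π)
      ψ (σ , π) = encode i (decode i σ ∘ₚ T) , encode r (R ∘ₚ decode r π)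

      ψφ : ∀ h → ψ (φ h) ≡ h
      ψφ (σ , π) = cong₂ _,_
        (act-injective i λ k → trans (act-encode i _ k)
          (trans (cong (T ⟨$⟩ʳ_) (act-encode i _ k)) (inverseʳ T)))
        (act-injective r λ y → trans (act-encode r _ y)
          (trans (act-encode r _ (R ⟨$⟩ʳ y)) (cong (decode r π ⟨$⟩ʳ_) (inverseˡ R))))

      stabilises : ∀ h → Maps h A B → Maps (φ h) B B
      stabilises (σ , π) m z = begin
        lookup B (act (proj₂ (φ (σ , π))) z)       ≡⟨ cong (lookup B) (act-encode r _ z) ⟩
        lookup B (act π y)                         ≡⟨ m y ⟩
        permute σ (lookup A y)                     ≡⟨ Vec.tabulate-cong entry ⟩
        permute (proj₁ (φ (σ , π))) (lookup B z)   ∎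
        where
        open ≡-Reasoning
        y = R ⟨$⟩ˡ z
        entry : ∀ k → lookup (lookup A y) (act σ k) ≡ lookup (lookup B z) (act (proj₁ (φ (σ , π))) k)
        entry k = sym (begin
          lookup (lookup B z) (act (proj₁ (φ (σ , π))) k)
            ≡⟨ cong (lookup (lookup B z)) (act-encode i _ k) ⟩
          lookup (lookup B z) (T ⟨$⟩ˡ act σ k)
            ≡⟨ cong (λ z → lookup (lookup B z) (T ⟨$⟩ˡ act σ k)) (sym (inverseʳ R)) ⟩
          lookup (lookup B (R ⟨$⟩ʳ y)) (T ⟨$⟩ˡ act σ k)
            ≡⟨ maps-entry τ ρ A B h₀ (T ⟨$⟩ˡ act σ k) y ⟩
          lookup (lookup A y) (T ⟨$⟩ʳ (T ⟨$⟩ˡ act σ k))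
            ≡⟨ cong (lookup (lookup A y)) (inverseʳ T) ⟩
          lookup (lookup A y) (act σ k) ∎)

    fixed-permute : ∀ σ → fixed (permute σ) ≤ 2 ^ cycles i σ
    fixed-permute σ = ≤-trans
      (∑-mono (elems FColumn) λ x → ind-mono (permute σ x ≟ x) (Twisted.intertwines? finBool σ (λ _ b → b) x)
        λ eq k → trans (sym (Vec.lookup∘tabulate (λ k → lookup x (act σ k)) k)) (cong (λ v → lookup v k) eq))
      (Twisted.invariant-count finBool i σ)

    -- With c cycles in `σ`, `p` = 2^c bounds the number of columns fixed by `σ`, and `p + δ` = 2^i
    -- is the number of all columns.
    pairs-permute : ∀ σ → pairs {r} (λ _ → permute σ) ≤ fixBound i r (cycles i σ)
    pairs-permute σ = pairs-uniform (2 ^ cycles i σ) (2 ^ i ∸ 2 ^ cycles i σ)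
      (≤-reflexive (trans (card-finVec finBool i) (sym (m+[n∸m]≡n (^-monoʳ-≤ 2 (cycles≤n i σ))))))
      r (permute σ) (fixed-permute σ)

    module _ {J : Set} (FJ : Finite J) {P : J → Set} (P? : ∀ a → Dec (P a))
             (m : J → Fin i → Fin r → Bool)
             (inequivalent : ∀ a b → P a → P b → (α : Permutation′ i) (β : Permutation′ r) →
                (∀ x y → m a x y ≡ m b (α ⟨$⟩ʳ x) (β ⟨$⟩ʳ y)) → a ≡ b) where
      private
        matrix : J → Matrix
        matrix a = tabulate λ y → tabulate λ x → m a x y

        matrix-entry : ∀ a x y → lookup (lookup (matrix a) y) x ≡ m a x y
        matrix-entry a x y = trans (cong (λ v → lookup v x) (Vec.lookup∘tabulate (λ y → tabulate λ x → m a x y) y))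
                                   (Vec.lookup∘tabulate (λ x → m a x y) x)

        -- Going from `a` to `B` by `h` and on to `b` by the inverse of `h′` is an equivalence of
        -- `a` and `b`.
        common-image : ∀ a b B {h h′} → P a → P b → Maps h (matrix a) B → Maps h′ (matrix b) B → a ≡ b
        common-image a b B {σ , π} {τ , ρ} Pa Pb h h′ =
          inequivalent a b Pa Pb (flipₚ S ∘ₚ T) (decode r π ∘ₚ flipₚ R) entries
          where
          open ≡-Reasoning
          S = decode i σ
          T = decode i τ
          R = decode r ρ
          entries : ∀ x y → m a x y ≡ m b (T ⟨$⟩ʳ (S ⟨$⟩ˡ x)) (R ⟨$⟩ˡ act π y)
          entries x y = begin
            m a x y
              ≡⟨ matrix-entry a x y ⟨
            lookup (lookup (matrix a) y) x
              ≡⟨ cong (lookup (lookup (matrix a) y)) (inverseʳ S) ⟨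
            lookup (lookup (matrix a) y) (S ⟨$⟩ʳ (S ⟨$⟩ˡ x))
              ≡⟨ maps-entry σ π (matrix a) B h (S ⟨$⟩ˡ x) y ⟨
            lookup (lookup B (act π y)) (S ⟨$⟩ˡ x)
              ≡⟨ cong (λ z → lookup (lookup B z) (S ⟨$⟩ˡ x)) (inverseʳ R) ⟨
            lookup (lookup B (R ⟨$⟩ʳ (R ⟨$⟩ˡ act π y))) (S ⟨$⟩ˡ x)
              ≡⟨ maps-entry τ ρ (matrix b) B h′ (S ⟨$⟩ˡ x) (R ⟨$⟩ˡ act π y) ⟩
            lookup (lookup (matrix b) (R ⟨$⟩ˡ act π y)) (T ⟨$⟩ʳ (S ⟨$⟩ˡ x))
              ≡⟨ matrix-entry b _ _ ⟩
            m b (T ⟨$⟩ʳ (S ⟨$⟩ˡ x)) (R ⟨$⟩ˡ act π y) ∎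

        group-total : ∀ c → ∑ (elems group) (λ _ → c) ≡ i ! * (r ! * c)
        group-total c = trans (∑-cartesian _,_ (codes i) (codes r) _)
          (trans (∑-cong (codes i) λ _ → ∑-codes-const r c) (∑-codes-const i (r ! * c)))

        image : ∀ h (A : Matrix) → ∃ λ B → Maps h A B
        image (σ , π) A = tabulate column , λ y → trans (Vec.lookup∘tabulate column (act π y))
            (cong (λ z → permute σ (lookup A z)) (inverseˡ (decode r π)))
          where
          column : Fin r → Column
          column z = permute σ (lookup A (decode r π ⟨$⟩ˡ z))

        orbit-total : ∀ A → i ! * r ! ≤ ∑ matrices (transporters A)
        orbit-total A = begin
          i ! * r !
            ≡⟨ cong (i ! *_) (*-identityʳ (r !)) ⟨
          i ! * (r ! * 1)
            ≡⟨ group-total 1 ⟨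
          ∑ (elems group) (λ _ → 1)
            ≤⟨ ∑-mono (elems group) reached ⟩
          ∑ (elems group) (λ h → ∑ matrices (λ B → ind (maps? h A B)))
            ≡⟨ ∑-swap (elems group) matrices _ ⟩
          ∑ matrices (transporters A) ∎
          where
          open ≤-Reasoning
          reached : ∀ h → 1 ≤ ∑ matrices (λ B → ind (maps? h A B))
          reached h with image h A
          ... | B , mapsB = ≤-trans (≤-reflexive (sym (ind-yes (maps? h A B) mapsB)))
                                    (Finite.∑-≥ (finVec FColumn r) B (λ B → ind (maps? h A B)))

      -- Double count of the triples of a selected `a`, a group element and the matrix `B` it makes
      -- from `a`. Every `a` accounts for at least i! r! triples. For given `B` they all share one
      -- `a` and are at most as many as the symmetries of `B`. Summed over `B`, the symmetries are
      -- the pairs of a group element and a matrix it fixes.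
      burnside : ∑ (elems FJ) (λ a → ind (P? a)) * (i ! * r !)
                 ≤ ∑ (codes i) (λ σ → fixBound i r (cycles i σ))
      burnside = begin
        ∑ (elems FJ) (λ a → ind (P? a)) * (i ! * r !)
          ≡⟨ ∑-*ʳ (elems FJ) (i ! * r !) _ ⟨
        ∑ (elems FJ) (λ a → ind (P? a) * (i ! * r !))
          ≤⟨ ∑-mono (elems FJ) (λ a → *-monoʳ-≤ (ind (P? a)) (orbit-total (matrix a))) ⟩
        ∑ (elems FJ) (λ a → ind (P? a) * ∑ matrices (transporters (matrix a)))
          ≡⟨ ∑-cong (elems FJ) (λ a → ∑-*ˡ matrices (ind (P? a)) _) ⟨
        ∑ (elems FJ) (λ a → ∑ matrices (λ B → ind (P? a) * transporters (matrix a) B))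
          ≡⟨ ∑-swap (elems FJ) matrices _ ⟩
        ∑ matrices (λ B → ∑ (elems FJ) (λ a → ind (P? a) * transporters (matrix a) B))
          ≤⟨ ∑-mono matrices (λ B → ∑-exclusive FJ _ (transporters B B) (each B) (exclusive B)) ⟩
        ∑ matrices (λ B → transporters B B)
          ≡⟨ ∑-swap (elems group) matrices _ ⟨
        ∑ (elems group) (λ h → ∑ matrices (λ B → ind (maps? h B B)))
          ≡⟨ ∑-cartesian _,_ (codes i) (codes r) _ ⟩
        ∑ (codes i) (λ σ → pairs {r} (λ _ → permute σ))
          ≤⟨ ∑-mono (codes i) pairs-permute ⟩
        ∑ (codes i) (λ σ → fixBound i r (cycles i σ)) ∎
        where
        open ≤-Reasoning
        each : ∀ B a → ind (P? a) * transporters (matrix a) B ≤ transporters B B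
        each B a = ≤-trans (*-monoˡ-≤ _ (ind-≤1 (P? a)))
          (≤-trans (≤-reflexive (*-identityˡ _)) (transporters≤stabiliser (matrix a) B))

        extract : ∀ B a → 0 < ind (P? a) * transporters (matrix a) B →
                  P a × ∃ λ h → Maps h (matrix a) B
        extract B a pos with P? a
        ... | yes Pa with ∑-positive (elems group) (λ h → ind (maps? h (matrix a) B))
                            (subst (0 <_) (*-identityˡ _) pos)
        ...   | h , pos′ = Pa , h , ind-witness (maps? h (matrix a) B) pos′

        exclusive : ∀ B a b → 0 < ind (P? a) * transporters (matrix a) B →
                    0 < ind (P? b) * transporters (matrix b) B → a ≡ b
        exclusive B a b posa posb with extract B a posa | extract B b posb
        ... | Pa , h , mapsa | Pb , h′ , mapsb = common-image a b B Pa Pb mapsa mapsb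

  -- The growth of the weights

  rising : ℕ → ℕ → ℕ
  rising q zero    = 1
  rising q (suc r) = (q + r) * rising q r

  module WeightBounds (p δ : ℕ) (1≤p : 1 ≤ p) where
    open Weights p δ
    open ≤-Reasoning

    B-lower : ∀ s → (p + s) * B s ≤ B (suc s)
    B-lower zero    = ≤-reflexive (trans (*-identityʳ _) (+-identityʳ p))
    B-lower (suc s) = m≤m+n _ _

    B-growth : ∀ s → suc s * B s ≤ B (suc s)
    B-growth s = ≤-trans (*-monoˡ-≤ (B s) (+-monoˡ-≤ s 1≤p)) (B-lower s)

    -- `B-growth` absorbs the factor `suc s` of the second term of the recursion, leaving `δ`
    -- further copies of the preceding weight.
    B-upper : ∀ s → B (suc s) ≤ (p + δ + s) * B s
    B-upper zero    = ≤-trans (≤-trans (m≤m+n p δ) (m≤m+n _ 0)) (≤-reflexive (sym (*-identityʳ _)))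
    B-upper (suc s) = begin
      (p + suc s) * B (suc s) + suc s * (δ * B s)   ≡⟨ cong ((p + suc s) * B (suc s) +_) (*-shuffle (suc s) δ (B s)) ⟩
      (p + suc s) * B (suc s) + δ * (suc s * B s)   ≤⟨ +-monoʳ-≤ ((p + suc s) * B (suc s)) (*-monoʳ-≤ δ (B-growth s)) ⟩
      (p + suc s) * B (suc s) + δ * B (suc s)       ≡⟨ collect p δ (suc s) (B (suc s)) ⟩
      (p + δ + suc s) * B (suc s)                   ∎
      where
      collect : ∀ p δ s x → (p + s) * x + δ * x ≡ (p + δ + s) * x
      collect = solve-∀

    B≤rising : ∀ s → B s ≤ rising (p + δ) s
    B≤rising zero    = ≤-refl
    B≤rising (suc s) = ≤-trans (B-upper s) (*-monoʳ-≤ (p + δ + s) (B≤rising s))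

    module _ (i a b : ℕ) .{{_ : NonZero b}}
             (decay : (i + p) * (a * b) + i * (a * a) ≤ b * b * (p + δ)) where

      private
        first : p * a ≤ (p + δ) * b
        first = *-cancelʳ-≤ (p * a) ((p + δ) * b) b (begin
          p * a * b                              ≡⟨ *-assoc p a b ⟩
          p * (a * b)                            ≤⟨ *-monoˡ-≤ (a * b) (m≤n+m p i) ⟩
          (i + p) * (a * b)                      ≤⟨ m≤m+n _ _ ⟩
          (i + p) * (a * b) + i * (a * a)        ≤⟨ decay ⟩
          b * b * (p + δ)                        ≡⟨ commute b (p + δ) ⟩
          (p + δ) * b * b                        ∎)
          where
          commute : ∀ b q → b * b * q ≡ q * b * b
          commute = solve-∀

      -- Put x = b / a. The claim is B(k) ≤ x^k q (q + 1) ⋯ (q + k - 1) with q = `p + δ`, and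
      -- `decay` reads (i + p) x + i ≤ x² q, which is what the two-term recursion needs to gain a
      -- factor x at each step. The coefficient `suc k` there must not exceed `i`, hence the range
      -- of `k`.
      B-decay : ∀ k → k ≤ suc i → B k * a ^ k ≤ b ^ k * rising (p + δ) k
      B-decay zero          _ = ≤-refl
      B-decay (suc zero)    _ = begin
        p * (a * 1)                  ≡⟨ cong (p *_) (*-identityʳ a) ⟩
        p * a                        ≤⟨ first ⟩
        (p + δ) * b                  ≡⟨ rearrange (p + δ) b ⟩
        b * 1 * ((p + δ + 0) * 1)    ∎
        where
        rearrange : ∀ q b → q * b ≡ b * 1 * ((q + 0) * 1)
        rearrange = solve-∀
      B-decay (suc (suc k)) (s≤s k<i) = begin
        ((p + suc k) * B (suc k) + suc k * (δ * B k)) * (a * (a * a ^ k))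
          ≡⟨ expand p δ (suc k) a (B (suc k)) (B k) (a ^ k) ⟩
        (p + suc k) * a * (B (suc k) * (a * a ^ k)) + suc k * δ * (a * a) * (B k * a ^ k)
          ≤⟨ +-mono-≤ (*-monoʳ-≤ ((p + suc k) * a) (B-decay (suc k) (m≤n⇒m≤1+n k<i)))
                      (*-monoʳ-≤ (suc k * δ * (a * a)) (B-decay k (m≤n⇒m≤1+n (<⇒≤ k<i)))) ⟩
        (p + suc k) * a * (b * b ^ k * R₁) + suc k * δ * (a * a) * (b ^ k * R₀)
          ≡⟨ regroup p δ (suc k) a b (b ^ k) R₁ R₀ ⟩
        b ^ k * ((p + suc k) * (a * b) * R₁ + suc k * (a * a) * (δ * R₀))
          ≤⟨ *-monoʳ-≤ (b ^ k) (+-mono-≤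
               (*-monoˡ-≤ R₁ (*-monoˡ-≤ (a * b) (≤-trans (≤-reflexive (+-comm p (suc k))) (+-monoˡ-≤ p k<i))))
               (*-mono-≤ (*-monoˡ-≤ (a * a) k<i) (*-monoˡ-≤ R₀ (≤-trans (m≤n+m δ p) (m≤m+n (p + δ) k))))) ⟩
        b ^ k * ((i + p) * (a * b) * R₁ + i * (a * a) * R₁)
          ≡⟨ cong (b ^ k *_) (*-distribʳ-+ R₁ ((i + p) * (a * b)) (i * (a * a))) ⟨
        b ^ k * (((i + p) * (a * b) + i * (a * a)) * R₁)
          ≤⟨ *-monoʳ-≤ (b ^ k) (*-monoˡ-≤ R₁ (≤-trans decay (*-monoʳ-≤ (b * b) (m≤m+n (p + δ) (suc k))))) ⟩
        b ^ k * (b * b * (p + δ + suc k) * R₁)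
          ≡⟨ reassociate b (b ^ k) (p + δ + suc k) R₁ ⟩
        b * (b * b ^ k) * ((p + δ + suc k) * R₁) ∎
        where
        R₁ = rising (p + δ) (suc k)
        R₀ = rising (p + δ) k
        expand : ∀ p δ k a x y z → ((p + k) * x + k * (δ * y)) * (a * (a * z))
                 ≡ (p + k) * a * (x * (a * z)) + k * δ * (a * a) * (y * z)
        expand = solve-∀
        regroup : ∀ p δ k a b z x y → (p + k) * a * (b * z * x) + k * δ * (a * a) * (z * y)
                  ≡ z * ((p + k) * (a * b) * x + k * (a * a) * (δ * y))
        regroup = solve-∀
        reassociate : ∀ b z q x → z * (b * b * q * x) ≡ b * (b * z) * (q * x)
        reassociate = solve-∀

  1≤2^ : ∀ c → 1 ≤ 2 ^ c
  1≤2^ c = m^n>0 2 c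

  2^c+δ : ∀ {i c} → c ≤ i → 2 ^ c + (2 ^ i ∸ 2 ^ c) ≡ 2 ^ i
  2^c+δ c≤i = m+[n∸m]≡n (^-monoʳ-≤ 2 c≤i)

  cycleSum : ∀ i → (ℕ → ℕ) → ℕ
  cycleSum i F = ∑ (codes i) (λ σ → F (cycles i σ))

  -- The Stirling recurrence: the new point is a cycle of its own or is inserted after one of the
  -- `i` old points.
  cycleSum-suc : ∀ i F → cycleSum (suc i) F ≡ cycleSum i (F ∘ suc) + i * cycleSum i F
  cycleSum-suc i F = trans (∑-codes-suc i _) (cong (cycleSum i (F ∘ suc) +_) (∑-fins-const i (cycleSum i F)))

  cycleSum-mono : ∀ i {F G} → (∀ c → c ≤ i → F c ≤ G c) → cycleSum i F ≤ cycleSum i G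
  cycleSum-mono i F≤G = ∑-mono (codes i) (λ σ → F≤G (cycles i σ) (cycles≤n i σ))

  fixBound-growth : ∀ i r → suc r * cycleSum i (fixBound i r) ≤ cycleSum i (fixBound i (suc r))
  fixBound-growth i r = ≤-trans (≤-reflexive (sym (∑-*ˡ (codes i) (suc r) _)))
    (cycleSum-mono i λ c _ → WeightBounds.B-growth (2 ^ c) (2 ^ i ∸ 2 ^ c) (1≤2^ c) r)

  fixBound-upper : ∀ i r → cycleSum i (fixBound i (suc r)) ≤ (2 ^ i + r) * cycleSum i (fixBound i r)
  fixBound-upper i r = ≤-trans
    (cycleSum-mono i λ c c≤i → subst (λ q → fixBound i (suc r) c ≤ (q + r) * fixBound i r c) (2^c+δ c≤i)
      (WeightBounds.B-upper (2 ^ c) (2 ^ i ∸ 2 ^ c) (1≤2^ c) r))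
    (≤-reflexive (∑-*ˡ (codes i) (2 ^ i + r) _))

  -- The case r = i + 1, small i

  dot : List ℕ → (ℕ → ℕ) → ℕ
  dot []       F = 0
  dot (c ∷ cs) F = c * F 0 + dot cs (F ∘ suc)

  addRow : List ℕ → List ℕ → List ℕ
  addRow []       ds       = ds
  addRow (c ∷ cs) []       = c ∷ cs
  addRow (c ∷ cs) (d ∷ ds) = c + d ∷ addRow cs ds

  dot-add : ∀ cs ds F → dot (addRow cs ds) F ≡ dot cs F + dot ds F
  dot-add []       ds       F = refl
  dot-add (c ∷ cs) []       F = sym (+-identityʳ _)
  dot-add (c ∷ cs) (d ∷ ds) F rewrite dot-add cs ds (F ∘ suc) =
    distribute c d (F 0) (dot cs (F ∘ suc)) (dot ds (F ∘ suc))
    where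
    distribute : ∀ c d x y z → (c + d) * x + (y + z) ≡ c * x + y + (d * x + z)
    distribute = solve-∀

  dot-scale : ∀ k cs F → dot (map (k *_) cs) F ≡ k * dot cs F
  dot-scale k []       F = sym (*-zeroʳ k)
  dot-scale k (c ∷ cs) F rewrite dot-scale k cs (F ∘ suc) = distribute k c (F 0) (dot cs (F ∘ suc))
    where
    distribute : ∀ k c x y → k * c * x + k * y ≡ k * (c * x + y)
    distribute = solve-∀

  nextRow : ℕ → List ℕ → List ℕ
  nextRow i cs = addRow (0 ∷ cs) (map (i *_) cs)

  -- Unsigned Stirling numbers of the first kind: entry c of row `i` counts the permutations of `i`
  -- points with c cycles.
  stirling : ℕ → List ℕ
  stirling zero    = 1 ∷ []
  stirling (suc i) = nextRow i (stirling i)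

  cycleSum-stirling : ∀ i F → cycleSum i F ≡ dot (stirling i) F
  cycleSum-stirling zero    F = cong (_+ 0) (sym (+-identityʳ (F 0)))
  cycleSum-stirling (suc i) F = trans (cycleSum-suc i F)
    (trans (cong₂ _+_ (cycleSum-stirling i (F ∘ suc)) (cong (i *_) (cycleSum-stirling i F)))
           (sym (trans (dot-add (0 ∷ stirling i) (map (i *_) (stirling i)) F)
                       (cong (dot (stirling i) (F ∘ suc) +_) (dot-scale i (stirling i) F)))))

  -- A linear-time evaluation of B, whose defining recursion is exponential.
  module Iterate (p δ : ℕ) where
    open Weights p δ

    iterate : ℕ → ℕ → ℕ → ℕ → ℕ
    iterate zero    s a b = a
    iterate (suc k) s a b = iterate k (suc s) b ((p + suc s) * b + suc s * (δ * a))

    iterate-correct : ∀ k s → iterate k s (B s) (B (suc s)) ≡ B (k + s)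
    iterate-correct zero    s = refl
    iterate-correct (suc k) s = trans (iterate-correct k (suc s)) (cong B (+-suc k s))

  fastBound : ℕ → ℕ → ℕ → ℕ
  fastBound i r c = Iterate.iterate (2 ^ c) (2 ^ i ∸ 2 ^ c) r 0 1 (2 ^ c)

  fastBound-correct : ∀ i r c → fastBound i r c ≡ fixBound i r c
  fastBound-correct i r c = trans (Iterate.iterate-correct (2 ^ c) (2 ^ i ∸ 2 ^ c) r 0)
                                  (cong (λ r → fixBound i r c) (+-identityʳ r))

  diagonalTest : ℕ → Bool
  diagonalTest i = dot (stirling i) (fastBound i (suc i)) ≤ᵇ 2 * rising (2 ^ i) (suc i)

  diagonalTests : ℕ → Bool
  diagonalTests zero    = true
  diagonalTests (suc n) = diagonalTest n ∧ diagonalTests n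

  diagonalTests-sound : ∀ n → Bool.T (diagonalTests n) → ∀ i → i < n → Bool.T (diagonalTest i)
  diagonalTests-sound (suc n) t i (s≤s i≤n) with Equivalence.to Bool.T-∧ t | m≤n⇒m<n∨m≡n i≤n
  ... | _ , ts | inj₁ i<n  = diagonalTests-sound n ts i i<n
  ... | t₀ , _ | inj₂ refl = t₀

  diagonal-small : ∀ i → i < 34 → cycleSum i (fixBound i (suc i)) ≤ 2 * rising (2 ^ i) (suc i)
  diagonal-small i i<34 = ≤-trans
    (≤-reflexive (trans (∑-cong (codes i) λ σ → sym (fastBound-correct i (suc i) (cycles i σ)))
                        (cycleSum-stirling i (fastBound i (suc i)))))
    -- `tt` is accepted because `diagonalTests 34` evaluates to `true`; type checking carries out
    -- all 34 comparisons.
    (≤ᵇ⇒≤ (dot (stirling i) (fastBound i (suc i))) _ (diagonalTests-sound 34 tt i i<34))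

  -- The case r = i + 1, large i

  ^-distribʳ-* : ∀ m n o → (m * n) ^ o ≡ m ^ o * n ^ o
  ^-distribʳ-* m n zero    = refl
  ^-distribʳ-* m n (suc o) rewrite ^-distribʳ-* m n o = interchange m n (m ^ o) (n ^ o)
    where
    interchange : ∀ a b c d → a * b * (c * d) ≡ a * c * (b * d)
    interchange = solve-∀

  ^-swap : ∀ m n o → (m ^ n) ^ o ≡ (m ^ o) ^ n
  ^-swap m n o = trans (^-*-assoc m n o) (trans (cong (m ^_) (*-comm n o)) (sym (^-*-assoc m o n)))

  ∏-linear : ℕ → ℕ → ℕ → ℕ
  ∏-linear X Y zero    = 1
  ∏-linear X Y (suc m) = (X + m * Y) * ∏-linear X Y m

  -- Homogeneous form of the generating function of the Stirling numbers: with z = Y / X, the sum of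
  -- z^(i - c(σ)) is the product of the 1 + j z for j < i.
  cycleSum-linear : ∀ X Y i → cycleSum i (λ c → X ^ c * Y ^ (i ∸ c)) ≡ ∏-linear X Y i
  cycleSum-linear X Y zero    = refl
  cycleSum-linear X Y (suc i) = begin
    cycleSum (suc i) (λ c → X ^ c * Y ^ (suc i ∸ c))
      ≡⟨ cycleSum-suc i (λ c → X ^ c * Y ^ (suc i ∸ c)) ⟩
    cycleSum i (λ c → X * X ^ c * Y ^ (i ∸ c)) + i * cycleSum i (λ c → X ^ c * Y ^ (suc i ∸ c))
      ≡⟨ cong₂ (λ a b → a + i * b)
           (trans (∑-cong (codes i) λ σ → *-assoc X _ _) (∑-*ˡ (codes i) X _))
           (trans (∑-cong (codes i) λ σ → extract (cycles i σ) (cycles≤n i σ)) (∑-*ˡ (codes i) Y _)) ⟩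
    X * S + i * (Y * S)
      ≡⟨ cong (λ s → X * s + i * (Y * s)) (cycleSum-linear X Y i) ⟩
    X * ∏-linear X Y i + i * (Y * ∏-linear X Y i)
      ≡⟨ collect X Y i _ ⟩
    (X + i * Y) * ∏-linear X Y i ∎
    where
    open ≡-Reasoning
    S = cycleSum i (λ c → X ^ c * Y ^ (i ∸ c))
    collect : ∀ X Y i s → X * s + i * (Y * s) ≡ (X + i * Y) * s
    collect = solve-∀
    extract : ∀ c → c ≤ i → X ^ c * Y ^ (suc i ∸ c) ≡ Y * (X ^ c * Y ^ (i ∸ c))
    extract c c≤i rewrite +-∸-assoc 1 c≤i = *-shuffle (X ^ c) Y (Y ^ (i ∸ c))

  ∏-linear-bound : ∀ X Y i .{{_ : NonZero i}} → 2 * (i * i) * Y ≤ X → ∏-linear X Y i ≤ 2 * X ^ i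
  ∏-linear-bound X Y i small = *-cancelʳ-≤ _ _ i
    (≤-trans (telescope i i ≤-refl refl) (≤-reflexive (commute i (X ^ i))))
    where
    open ≤-Reasoning
    commute : ∀ i x → (i + i) * x ≡ 2 * x * i
    commute = solve-∀
    -- With z = Y / X the invariant says that the product of the 1 + j z for j < m is at most 2i /
    -- (2i - m). The step is 1 + m z ≤ (e + 1) / e, valid as m e z ≤ 2 i² z ≤ 1. At m = e = i the
    -- bound is 2.
    telescope : ∀ m e → m ≤ i → m + e ≡ i + i → ∏-linear X Y m * e ≤ (i + i) * X ^ m
    telescope zero    e _   refl = ≤-reflexive (*-comm 1 (i + i))
    telescope (suc m) e m<i eq   = begin
      (X + m * Y) * Π * e           ≡⟨ expand X m Y Π e ⟩
      Π * (X * e + m * e * Y)       ≤⟨ *-monoʳ-≤ Π (+-monoʳ-≤ (X * e) (≤-trans (*-monoˡ-≤ Y me≤) small)) ⟩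
      Π * (X * e + X)               ≡⟨ collect Π X e ⟩
      X * (Π * suc e)               ≤⟨ *-monoʳ-≤ X (telescope m (suc e) (<⇒≤ m<i) (trans (+-suc m e) eq)) ⟩
      X * ((i + i) * X ^ m)         ≡⟨ *-shuffle X (i + i) (X ^ m) ⟩
      (i + i) * (X * X ^ m)         ∎
      where
      Π = ∏-linear X Y m
      expand : ∀ X m Y p e → (X + m * Y) * p * e ≡ p * (X * e + m * e * Y)
      expand = solve-∀
      collect : ∀ p X e → p * (X * e + X) ≡ X * (p * suc e)
      collect = solve-∀
      double : ∀ i → i * (i + i) ≡ 2 * (i * i)
      double = solve-∀
      me≤ : m * e ≤ 2 * (i * i)
      me≤ = ≤-trans (*-mono-≤ (<⇒≤ m<i) (≤-trans (m≤n+m e (suc m)) (≤-reflexive eq))) (≤-reflexive (double i))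

  induction-from : ∀ b (P : ℕ → Set) → P b → (∀ i → b ≤ i → P i → P (suc i)) → ∀ i → b ≤ i → P i
  induction-from b P base step zero    b≤0  = subst P (n≤0⇒n≡0 b≤0) base
  induction-from b P base step (suc i) b≤1+i with m≤n⇒m<n∨m≡n b≤1+i
  ... | inj₁ (s≤s b≤i) = step i b≤i (induction-from b P base step i b≤i)
  ... | inj₂ refl      = base

  25^i≤32^i : ∀ i → 34 ≤ i → 16 * i * 25 ^ i ≤ 3 * 32 ^ i
  25^i≤32^i = induction-from 34 (λ i → 16 * i * 25 ^ i ≤ 3 * 32 ^ i)
                             (≤ᵇ⇒≤ (16 * 34 * 25 ^ 34) (3 * 32 ^ 34) tt) step
    where
    open ≤-Reasoning
    step : ∀ i → 34 ≤ i → 16 * i * 25 ^ i ≤ 3 * 32 ^ i → 16 * suc i * 25 ^ suc i ≤ 3 * 32 ^ suc i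
    step i 34≤i ih = begin
      16 * suc i * (25 * 25 ^ i)      ≡⟨ expand i (25 ^ i) ⟩
      -- 25 ≤ 238 = 7 · 34 ≤ 7 i, and 25 + 7 = 32.
      16 * (25 * i + 25) * 25 ^ i     ≤⟨ *-monoˡ-≤ (25 ^ i) (*-monoʳ-≤ 16 (+-monoʳ-≤ (25 * i) (≤-trans (≤ᵇ⇒≤ 25 238 tt) (*-monoʳ-≤ 7 34≤i)))) ⟩
      16 * (25 * i + 7 * i) * 25 ^ i  ≡⟨ collect i (25 ^ i) ⟩
      32 * (16 * i * 25 ^ i)          ≤⟨ *-monoʳ-≤ 32 ih ⟩
      32 * (3 * 32 ^ i)               ≡⟨ shuffle (32 ^ i) ⟩
      3 * (32 * 32 ^ i)               ∎
      where
      expand : ∀ i x → 16 * suc i * (25 * x) ≡ 16 * (25 * i + 25) * x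
      expand = solve-∀
      collect : ∀ i x → 16 * (25 * i + 7 * i) * x ≡ 32 * (16 * i * x)
      collect = solve-∀
      shuffle : ∀ x → 32 * (3 * x) ≡ 3 * (32 * x)
      shuffle = solve-∀

  -- This is 2 i² z ≤ 1 for z = (4/5)^(i + 1). It fails at i = 33, which places the border between
  -- computation and estimate at 34.
  4^i≤5^i : ∀ i → 34 ≤ i → 2 * (i * i) * 4 ^ suc i ≤ 5 ^ suc i
  4^i≤5^i = induction-from 34 (λ i → 2 * (i * i) * 4 ^ suc i ≤ 5 ^ suc i)
                           (≤ᵇ⇒≤ (2 * (34 * 34) * 4 ^ 35) (5 ^ 35) tt) step
    where
    open ≤-Reasoning
    step : ∀ i → 34 ≤ i → 2 * (i * i) * 4 ^ suc i ≤ 5 ^ suc i →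
           2 * (suc i * suc i) * 4 ^ suc (suc i) ≤ 5 ^ suc (suc i)
    step i 34≤i ih = begin
      2 * (suc i * suc i) * (4 * x)                        ≡⟨ expand i x ⟩
      2 * (4 * (i * i) + (8 * i + 4)) * x                  ≤⟨ *-monoˡ-≤ x (*-monoʳ-≤ 2 (+-monoʳ-≤ (4 * (i * i)) slack)) ⟩
      2 * (4 * (i * i) + i * i) * x                        ≡⟨ collect i x ⟩
      5 * (2 * (i * i) * x)                                ≤⟨ *-monoʳ-≤ 5 ih ⟩
      5 * 5 ^ suc i                                        ∎
      where
      x = 4 ^ suc i
      12≤i : 12 ≤ i
      12≤i = ≤-trans (≤ᵇ⇒≤ 12 34 tt) 34≤i
      slack : 8 * i + 4 ≤ i * i
      slack = ≤-trans (+-monoʳ-≤ (8 * i) (≤-trans (≤ᵇ⇒≤ 4 48 tt) (*-monoʳ-≤ 4 12≤i)))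
        (≤-trans (≤-reflexive (sym (*-distribʳ-+ i 8 4))) (*-monoˡ-≤ i 12≤i))
      expand : ∀ i x → 2 * (suc i * suc i) * (4 * x) ≡ 2 * (4 * (i * i) + (8 * i + 4)) * x
      expand = solve-∀
      collect : ∀ i x → 2 * (4 * (i * i) + i * i) * x ≡ 5 * (2 * (i * i) * x)
      collect = solve-∀

  module Large (i : ℕ) (34≤i : 34 ≤ i) where
    open ≤-Reasoning

    -- The hypothesis of `B-decay` for x = (4/5)^(d + 1). After multiplication by 8 · 25^c the right
    -- side is 8 · 32^(d + 1) · 50^c; three of these eight parts cover the two terms with factor i,
    -- the other five the term with 2^c.
    decay-condition : ∀ c d → c + suc d ≡ i →
      (i + 2 ^ c) * (5 ^ suc d * 4 ^ suc d) + i * (5 ^ suc d * 5 ^ suc d) ≤ 4 ^ suc d * 4 ^ suc d * 2 ^ i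
    decay-condition c d c+d≡i = *-cancelʳ-≤ _ _ (8 * 25 ^ c) {{m*n≢0 8 (25 ^ c) {{_}} {{m^n≢0 25 c}}}} (begin
      ((i + 2 ^ c) * (5 ^ D * 4 ^ D) + i * (5 ^ D * 5 ^ D)) * (8 * 25 ^ c)
        ≡⟨ cong₂ (λ u v → ((i + 2 ^ c) * u + i * v) * (8 * 25 ^ c)) (sym (^-distribʳ-* 5 4 D)) (sym (^-distribʳ-* 5 5 D)) ⟩
      ((i + 2 ^ c) * 20 ^ D + i * 25 ^ D) * (8 * 25 ^ c)
        ≡⟨ expand i (2 ^ c) (20 ^ D) (25 ^ D) (25 ^ c) ⟩
      8 * i * (25 ^ c * 20 ^ D) + 8 * i * (25 ^ c * 25 ^ D) + 8 * 20 ^ D * (2 ^ c * 25 ^ c)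
        ≤⟨ +-mono-≤ (+-monoˡ-≤ _ (*-monoʳ-≤ (8 * i) (*-monoʳ-≤ (25 ^ c) (^-monoˡ-≤ D (≤ᵇ⇒≤ 20 25 tt)))))
                    (*-monoˡ-≤ (2 ^ c * 25 ^ c) 20≤32) ⟩
      8 * i * (25 ^ c * 25 ^ D) + 8 * i * (25 ^ c * 25 ^ D) + 5 * 32 ^ D * (2 ^ c * 25 ^ c)
        ≡⟨ cong₂ (λ u v → 8 * i * u + 8 * i * u + 5 * 32 ^ D * v) 25^ 50^ ⟩
      8 * i * 25 ^ i + 8 * i * 25 ^ i + 5 * 32 ^ D * 50 ^ c
        ≡⟨ cong (_+ 5 * 32 ^ D * 50 ^ c) (collect i (25 ^ i)) ⟩
      16 * i * 25 ^ i + 5 * 32 ^ D * 50 ^ c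
        ≤⟨ +-monoˡ-≤ _ (25^i≤32^i i 34≤i) ⟩
      3 * 32 ^ i + 5 * 32 ^ D * 50 ^ c
        ≤⟨ +-monoˡ-≤ _ (*-monoʳ-≤ 3 32^≤) ⟩
      3 * (32 ^ D * 50 ^ c) + 5 * 32 ^ D * 50 ^ c
        ≡⟨ combine (32 ^ D) (50 ^ c) ⟩
      32 ^ D * 50 ^ c * 8
        ≡⟨ cong (_* 8) final ⟩
      4 ^ D * 4 ^ D * 2 ^ i * 25 ^ c * 8
        ≡⟨ reassociate (4 ^ D * 4 ^ D * 2 ^ i) (25 ^ c) ⟩
      4 ^ D * 4 ^ D * 2 ^ i * (8 * 25 ^ c) ∎)
      where
      D = suc d
      expand : ∀ i u v w z → ((i + u) * v + i * w) * (8 * z) ≡ 8 * i * (z * v) + 8 * i * (z * w) + 8 * v * (u * z)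
      expand = solve-∀
      collect : ∀ i x → 8 * i * x + 8 * i * x ≡ 16 * i * x
      collect = solve-∀
      combine : ∀ x y → 3 * (x * y) + 5 * x * y ≡ x * y * 8
      combine = solve-∀
      reassociate : ∀ x y → x * y * 8 ≡ x * (8 * y)
      reassociate = solve-∀
      split : ∀ a → a ^ i ≡ a ^ c * a ^ D
      split a = trans (cong (a ^_) (sym c+d≡i)) (^-distribˡ-+-* a c D)
      25^ : 25 ^ c * 25 ^ D ≡ 25 ^ i
      25^ = sym (split 25)
      50^ : 2 ^ c * 25 ^ c ≡ 50 ^ c
      50^ = sym (^-distribʳ-* 2 25 c)
      -- 8 · 20 = 5 · 32 gives the share of five; it relies on the exponent `D` being at least 1.
      20≤32 : 8 * (20 * 20 ^ d) ≤ 5 * (32 * 32 ^ d)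
      20≤32 = begin
        8 * (20 * 20 ^ d)   ≡⟨ *-assoc 8 20 (20 ^ d) ⟨
        160 * 20 ^ d        ≤⟨ *-monoʳ-≤ 160 (^-monoˡ-≤ d (≤ᵇ⇒≤ 20 32 tt)) ⟩
        160 * 32 ^ d        ≡⟨ *-assoc 5 32 (32 ^ d) ⟩
        5 * (32 * 32 ^ d)   ∎
      32^≤ : 32 ^ i ≤ 32 ^ D * 50 ^ c
      32^≤ = ≤-trans (≤-reflexive (trans (split 32) (*-comm (32 ^ c) (32 ^ D))))
                     (*-monoʳ-≤ (32 ^ D) (^-monoˡ-≤ c (≤ᵇ⇒≤ 32 50 tt)))
      final : 32 ^ D * 50 ^ c ≡ 4 ^ D * 4 ^ D * 2 ^ i * 25 ^ c
      final = begin-equality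
        32 ^ D * 50 ^ c
          ≡⟨ cong₂ _*_ (trans (^-distribʳ-* 16 2 D) (cong (_* 2 ^ D) (^-distribʳ-* 4 4 D))) (^-distribʳ-* 2 25 c) ⟩
        4 ^ D * 4 ^ D * 2 ^ D * (2 ^ c * 25 ^ c)
          ≡⟨ regroup (4 ^ D * 4 ^ D) (2 ^ D) (2 ^ c) (25 ^ c) ⟩
        4 ^ D * 4 ^ D * (2 ^ c * 2 ^ D) * 25 ^ c
          ≡⟨ cong (λ x → 4 ^ D * 4 ^ D * x * 25 ^ c) (split 2) ⟨
        4 ^ D * 4 ^ D * 2 ^ i * 25 ^ c ∎
        where
        regroup : ∀ x y z w → x * y * (z * w) ≡ x * (z * y) * w
        regroup = solve-∀

    private
      X = 5 ^ suc i
      Y = 4 ^ suc i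
      Q = rising (2 ^ i) (suc i)

    fixBound-decay : ∀ c d → c + d ≡ i → fixBound i (suc i) c * X ^ d ≤ Y ^ d * Q
    -- Here σ is the identity and the ratio is 1. The decay condition fails for that ratio, so the
    -- plain bound `B≤rising` is used.
    fixBound-decay c zero    c+0≡i = begin
      fixBound i (suc i) c * 1             ≡⟨ *-identityʳ _ ⟩
      fixBound i (suc i) c                 ≤⟨ WeightBounds.B≤rising (2 ^ c) (2 ^ i ∸ 2 ^ c) (1≤2^ c) (suc i) ⟩
      rising (2 ^ c + (2 ^ i ∸ 2 ^ c)) (suc i) ≡⟨ cong (λ q → rising q (suc i)) (2^c+δ c≤i) ⟩
      Q                                    ≡⟨ *-identityˡ Q ⟨
      1 * Q                                ∎
      where
      c≤i : c ≤ i
      c≤i = ≤-trans (m≤m+n c 0) (≤-reflexive c+0≡i)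
    fixBound-decay c (suc d) c+d≡i = begin
      fixBound i (suc i) c * X ^ suc d
        ≡⟨ cong (fixBound i (suc i) c *_) (^-swap 5 (suc i) (suc d)) ⟩
      fixBound i (suc i) c * (5 ^ suc d) ^ suc i
        ≤⟨ WeightBounds.B-decay (2 ^ c) (2 ^ i ∸ 2 ^ c) (1≤2^ c) i (5 ^ suc d) (4 ^ suc d) {{m^n≢0 4 (suc d)}}
             (subst (λ q → (i + 2 ^ c) * (5 ^ suc d * 4 ^ suc d) + i * (5 ^ suc d * 5 ^ suc d) ≤ 4 ^ suc d * 4 ^ suc d * q)
                    (sym (2^c+δ c≤i)) (decay-condition c d c+d≡i))
             (suc i) ≤-refl ⟩
      (4 ^ suc d) ^ suc i * rising (2 ^ c + (2 ^ i ∸ 2 ^ c)) (suc i)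
        ≡⟨ cong₂ (λ y q → y * rising q (suc i)) (^-swap 4 (suc d) (suc i)) (2^c+δ c≤i) ⟩
      Y ^ suc d * Q ∎
      where
      c≤i : c ≤ i
      c≤i = ≤-trans (m≤m+n c (suc d)) (≤-reflexive c+d≡i)

    -- With z = Y / X each term is at most z^(i - c) Q, and these powers of z sum to at most 2.
    -- Multiplying by X^i clears the denominators.
    diagonal-large : cycleSum i (fixBound i (suc i)) ≤ 2 * Q
    diagonal-large = *-cancelʳ-≤ _ _ (X ^ i) {{m^n≢0 X i {{m^n≢0 5 (suc i)}}}} (begin
      cycleSum i (fixBound i (suc i)) * X ^ i
        ≡⟨ ∑-*ʳ (codes i) (X ^ i) _ ⟨
      cycleSum i (λ c → fixBound i (suc i) c * X ^ i)
        ≤⟨ cycleSum-mono i each ⟩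
      cycleSum i (λ c → X ^ c * Y ^ (i ∸ c) * Q)
        ≡⟨ ∑-*ʳ (codes i) Q _ ⟩
      cycleSum i (λ c → X ^ c * Y ^ (i ∸ c)) * Q
        ≡⟨ cong (_* Q) (cycleSum-linear X Y i) ⟩
      ∏-linear X Y i * Q
        ≤⟨ *-monoˡ-≤ Q (∏-linear-bound X Y i {{>-nonZero (≤-trans (s≤s z≤n) 34≤i)}}
             (4^i≤5^i i 34≤i)) ⟩
      2 * X ^ i * Q
        ≡⟨ commute (X ^ i) Q ⟩
      2 * Q * X ^ i ∎)
      where
      commute : ∀ x q → 2 * x * q ≡ 2 * q * x
      commute = solve-∀
      each : ∀ c → c ≤ i → fixBound i (suc i) c * X ^ i ≤ X ^ c * Y ^ (i ∸ c) * Q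
      each c c≤i = begin
        F * X ^ i                       ≡⟨ cong (λ n → F * X ^ n) (m+[n∸m]≡n c≤i) ⟨
        F * X ^ (c + (i ∸ c))           ≡⟨ cong (F *_) (^-distribˡ-+-* X c (i ∸ c)) ⟩
        F * (X ^ c * X ^ (i ∸ c))       ≡⟨ *-shuffle F (X ^ c) _ ⟩
        X ^ c * (F * X ^ (i ∸ c))       ≤⟨ *-monoʳ-≤ (X ^ c) (fixBound-decay c (i ∸ c) (m+[n∸m]≡n c≤i)) ⟩
        X ^ c * (Y ^ (i ∸ c) * Q)       ≡⟨ *-assoc (X ^ c) _ Q ⟨
        X ^ c * Y ^ (i ∸ c) * Q         ∎
        where
        F = fixBound i (suc i) c

  diagonal : ∀ i → cycleSum i (fixBound i (suc i)) ≤ 2 * rising (2 ^ i) (suc i)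
  diagonal i with i <? 34
  ... | yes i<34 = diagonal-small i i<34
  ... | no  i≮34 = Large.diagonal-large i (≮⇒≥ i≮34)

  -- Induction from the diagonal: one more column multiplies the left side by at most 2^i + r and
  -- the right side by exactly that.
  cycleSum-bound : ∀ i r → i < r → cycleSum i (fixBound i r) ≤ 2 * rising (2 ^ i) r
  cycleSum-bound i (suc r) (s≤s i≤r) with m≤n⇒m<n∨m≡n i≤r
  ... | inj₂ refl = diagonal i
  ... | inj₁ i<r  = ≤-trans (fixBound-upper i r)
    (≤-trans (*-monoʳ-≤ (2 ^ i + r) (cycleSum-bound i r i<r))
             (≤-reflexive (shuffle (2 ^ i + r) (rising (2 ^ i) r))))
    where
    shuffle : ∀ a b → a * (2 * b) ≡ 2 * (a * b)
    shuffle = solve-∀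

  -- Counting classes of a given size

  [r+m]Cr : ∀ r m → ((r + m) C r) * (r ! * m !) ≡ (r + m) !
  [r+m]Cr r m = begin
    ((r + m) C r) * (r ! * m !)
      ≡⟨ cong (λ k → ((r + m) C r) * (r ! * k !)) (m+n∸m≡n r m) ⟨
    ((r + m) C r) * (r ! * (r + m ∸ r) !)
      ≡⟨ cong (_* (r ! * (r + m ∸ r) !)) (nCk≡n!/k![n-k]! (m≤m+n r m)) ⟩
    (((r + m) !) / (r ! * (r + m ∸ r) !)) {{r !* (r + m ∸ r) !≢0}} * (r ! * (r + m ∸ r) !)
      ≡⟨ m/n*n≡m {{r !* (r + m ∸ r) !≢0}} (k![n∸k]!∣n! (m≤m+n r m)) ⟩
    (r + m) ! ∎
    where open ≡-Reasoning

  rising-! : ∀ m r → rising (suc m) r * m ! ≡ (r + m) !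
  rising-! m zero    = *-identityˡ (m !)
  rising-! m (suc r) = trans (*-assoc (suc m + r) (rising (suc m) r) (m !))
    (cong₂ _*_ (cong suc (+-comm m r)) (rising-! m r))

  rising-C : ∀ q r → 1 ≤ q → ((r + q ∸ 1) C r) * r ! ≡ rising q r
  rising-C (suc m) r _ = *-cancelʳ-≡ _ _ (m !) {{m !≢0}} (begin
    ((r + suc m ∸ 1) C r) * r ! * m !  ≡⟨ cong (λ n → ((n ∸ 1) C r) * r ! * m !) (+-suc r m) ⟩
    ((r + m) C r) * r ! * m !          ≡⟨ *-assoc ((r + m) C r) (r !) (m !) ⟩
    ((r + m) C r) * (r ! * m !)        ≡⟨ [r+m]Cr r m ⟩
    (r + m) !                          ≡⟨ rising-! m r ⟨
    rising (suc m) r * m !             ∎)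
    where open ≡-Reasoning

  orbits-wide : ∀ i r N → i < r → N * (i ! * r !) ≤ cycleSum i (fixBound i r) →
                N * i ! ≤ 2 * ((r + 2 ^ i ∸ 1) C r)
  orbits-wide i r N i<r bound = *-cancelʳ-≤ _ _ (r !) {{r !≢0}} (begin
    N * i ! * r !                     ≡⟨ *-assoc N (i !) (r !) ⟩
    N * (i ! * r !)                   ≤⟨ bound ⟩
    cycleSum i (fixBound i r)         ≤⟨ cycleSum-bound i r i<r ⟩
    2 * rising (2 ^ i) r              ≡⟨ cong (2 *_) (rising-C (2 ^ i) r (1≤2^ i)) ⟨
    2 * (((r + 2 ^ i ∸ 1) C r) * r !) ≡⟨ *-assoc 2 ((r + 2 ^ i ∸ 1) C r) (r !) ⟨
    2 * ((r + 2 ^ i ∸ 1) C r) * r !   ∎)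
    where open ≤-Reasoning

  -- By `fixBound-growth` the count also satisfies the hypothesis for r + 1 columns, where the wide
  -- case applies; this is the source of the lower index r + 1 in the binomial coefficient.
  orbits-square : ∀ r N → N * (r ! * r !) ≤ cycleSum r (fixBound r r) →
                  N * r ! ≤ 2 * ((r + 2 ^ r) C (r + 1))
  orbits-square r N bound = subst (λ k → N * r ! ≤ 2 * ((r + 2 ^ r) C k)) (+-comm 1 r)
    (orbits-wide r (suc r) N ≤-refl (begin
      N * (r ! * (suc r * r !))            ≡⟨ shuffle N (r !) (suc r) ⟩
      suc r * (N * (r ! * r !))            ≤⟨ *-monoʳ-≤ (suc r) bound ⟩
      suc r * cycleSum r (fixBound r r)    ≤⟨ fixBound-growth r r ⟩
      cycleSum r (fixBound r (suc r))      ∎))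
    where
    open ≤-Reasoning
    shuffle : ∀ a b c → a * (b * (c * b)) ≡ c * (a * (b * b))
    shuffle = solve-∀

  orbits-empty : ∀ r N → N * (0 ! * r !) ≤ cycleSum 0 (fixBound 0 r) → N ≤ 1
  orbits-empty r N bound = *-cancelʳ-≤ N 1 (r !) {{r !≢0}} (begin
    N * r !                                    ≡⟨ cong (N *_) (*-identityˡ (r !)) ⟨
    N * (0 ! * r !)                            ≤⟨ bound ⟩
    fixBound 0 r 0 + 0                         ≡⟨ +-identityʳ _ ⟩
    fixBound 0 r 0                             ≤⟨ WeightBounds.B≤rising 1 0 ≤-refl r ⟩
    rising 1 r                                 ≡⟨ *-identityʳ _ ⟨
    rising 1 r * 0 !                           ≡⟨ rising-! 0 r ⟩
    (r + 0) !                                  ≡⟨ cong _! (+-identityʳ r) ⟩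
    r !                                        ≡⟨ *-identityˡ (r !) ⟨
    1 * r !                                    ∎)
    where open ≤-Reasoning

  -- The bound on the number of classes with a connected domain of size i, rounded down so that
  -- the counting stays in ℕ.
  quota : ℕ → ℕ → ℕ
  quota r zero      = 1
  quota r i@(suc _) with <-cmp i r
  ... | tri< _ _ _ = ((2 * ((r + 2 ^ i ∸ 1) C r)) / i !) {{i !≢0}}
  ... | tri≈ _ _ _ = ((2 * ((r + 2 ^ r) C (r + 1))) / r !) {{r !≢0}}
  ... | tri> _ _ _ = ((2 * ((i + 2 ^ r ∸ 1) C i)) / r !) {{r !≢0}}

  ≤-quotient : ∀ {N a} d .{{_ : NonZero d}} → N * d ≤ a → N ≤ a / d
  ≤-quotient {N} d N*d≤a = ≤-trans (≤-reflexive (sym (m*n/n≡m N d))) (/-monoˡ-≤ d N*d≤a)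

  -- The second hypothesis is the Burnside bound for the transposed matrices and serves r < i, since
  -- `orbits-wide` wants fewer rows than columns.
  ≤-quota : ∀ i r N → N * (i ! * r !) ≤ cycleSum i (fixBound i r) →
            N * (r ! * i !) ≤ cycleSum r (fixBound r i) → N ≤ quota r i
  ≤-quota zero      r N b bᵀ = orbits-empty r N b
  ≤-quota i@(suc _) r N b bᵀ with <-cmp i r
  ... | tri< i<r _ _  = ≤-quotient (i !) {{i !≢0}} (orbits-wide i r N i<r b)
  ... | tri≈ _ refl _ = ≤-quotient (r !) {{r !≢0}} (orbits-square r N b)
  ... | tri> _ _ r<i  = ≤-quotient (r !) {{r !≢0}} (orbits-wide r i N r<i bᵀ)

  quota-wide : ∀ i r → 0 < i → i < r → quota r i * i ! ≤ 2 * ((r + 2 ^ i ∸ 1) C r)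
  quota-wide i@(suc _) r _ i<r with <-cmp i r
  ... | tri< _ _ _   = m/n*n≤m _ (i !) {{i !≢0}}
  ... | tri≈ i≮r _ _ = contradiction i<r i≮r
  ... | tri> i≮r _ _ = contradiction i<r i≮r

  quota-square : ∀ r → 0 < r → quota r r * r ! ≤ 2 * ((r + 2 ^ r) C (r + 1))
  quota-square r@(suc _) _ with <-cmp r r
  ... | tri< _ r≢r _ = contradiction refl r≢r
  ... | tri≈ _ _ _   = m/n*n≤m _ (r !) {{r !≢0}}
  ... | tri> _ r≢r _ = contradiction refl r≢r

  quota-tall : ∀ i r → r < i → quota r i * r ! ≤ 2 * ((i + 2 ^ r ∸ 1) C i)
  quota-tall i@(suc _) r r<i with <-cmp i r
  ... | tri< _ _ r≮i = contradiction r<i r≮i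
  ... | tri≈ _ _ r≮i = contradiction r<i r≮i
  ... | tri> _ _ _   = m/n*n≤m _ (r !) {{r !≢0}}

  -- Restriction to the connected domain

  embed : ∀ {n} (S : Vec Bool n) → Fin (trues S) → Fin n
  embed (true ∷ S)  zero    = zero
  embed (true ∷ S)  (suc k) = suc (embed S k)
  embed (false ∷ S) k       = suc (embed S k)

  embed-injective : ∀ {n} (S : Vec Bool n) {k l} → embed S k ≡ embed S l → k ≡ l
  embed-injective (true ∷ S)  {zero}  {zero}  _  = refl
  embed-injective (true ∷ S)  {suc k} {suc l} eq = cong suc (embed-injective S (Fin.suc-injective eq))
  embed-injective (false ∷ S)                 eq = embed-injective S (Fin.suc-injective eq)

  lookup-embed : ∀ {n} (S : Vec Bool n) k → lookup S (embed S k) ≡ true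
  lookup-embed (true ∷ S)  zero    = refl
  lookup-embed (true ∷ S)  (suc k) = lookup-embed S k
  lookup-embed (false ∷ S) k       = lookup-embed S k

  locate : ∀ {n} (S : Vec Bool n) x → (∃ λ k → embed S k ≡ x) ⊎ lookup S x ≡ false
  locate (true ∷ S)  zero    = inj₁ (zero , refl)
  locate (false ∷ S) zero    = inj₂ refl
  locate (true ∷ S)  (suc x) with locate S x
  ... | inj₁ (k , eq) = inj₁ (suc k , cong suc eq)
  ... | inj₂ out      = inj₂ out
  locate (false ∷ S) (suc x) with locate S x
  ... | inj₁ (k , eq) = inj₁ (k , cong suc eq)
  ... | inj₂ out      = inj₂ out

  module _ {n} (S : Vec Bool n) where

    extendMap : (Fin (trues S) → Fin (trues S)) → Fin n → Fin n
    extendMap f x with locate S x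
    ... | inj₁ (k , _) = embed S (f k)
    ... | inj₂ _       = x

    extendMap-inside : ∀ f k → extendMap f (embed S k) ≡ embed S (f k)
    extendMap-inside f k with locate S (embed S k)
    ... | inj₁ (l , eq) = cong (embed S ∘ f) (embed-injective S eq)
    ... | inj₂ out      = contradiction (trans (sym (lookup-embed S k)) out) λ ()

    extendMap-outside : ∀ f x → lookup S x ≡ false → extendMap f x ≡ x
    extendMap-outside f x out with locate S x
    ... | inj₁ (k , refl) = contradiction (trans (sym (lookup-embed S k)) out) λ ()
    ... | inj₂ _          = refl

    extendMap-inverse : ∀ f g → (∀ k → f (g k) ≡ k) → ∀ x → extendMap f (extendMap g x) ≡ x
    extendMap-inverse f g fg x = go (locate S x)
      where
      go : (∃ λ k → embed S k ≡ x) ⊎ lookup S x ≡ false → extendMap f (extendMap g x) ≡ x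
      go (inj₁ (k , refl)) = trans (cong (extendMap f) (extendMap-inside g k))
        (trans (extendMap-inside f (g k)) (cong (embed S) (fg k)))
      go (inj₂ out)        = trans (cong (extendMap f) (extendMap-outside g x out)) (extendMap-outside f x out)

    extend : Permutation′ (trues S) → Permutation′ n
    extend σ = permutation (extendMap (σ ⟨$⟩ʳ_)) (extendMap (σ ⟨$⟩ˡ_))
      (extendMap-inverse _ _ λ _ → inverseʳ σ) (extendMap-inverse _ _ λ _ → inverseˡ σ)

  module _ {n r : ℕ} where

    inDomain? : (G : BipGraph n r) → ∀ x → Dec (InConnDomain G x)
    inDomain? G x = Fin.any? (λ y → G x y Bool.≟ true)

    domain : BipGraph n r → Vec Bool n
    domain G = tabulate (λ x → does (inDomain? G x))

    domain-true : ∀ G x → InConnDomain G x → lookup (domain G) x ≡ true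
    domain-true G x c = trans (Vec.lookup∘tabulate _ x) (dec-true (inDomain? G x) c)

    true-domain : ∀ G x → lookup (domain G) x ≡ true → InConnDomain G x
    true-domain G x eq with inDomain? G x
    ... | yes c = c
    ... | no ¬c = contradiction
      (trans (sym eq) (trans (Vec.lookup∘tabulate _ x) (dec-false (inDomain? G x) ¬c))) λ ()

    outside-domain : ∀ G x y → lookup (domain G) x ≡ false → G x y ≡ false
    outside-domain G x y out with G x y in eq
    ... | false = refl
    ... | true  = contradiction (trans (sym (domain-true G x (y , eq))) out) λ ()

    restrict : (S : Vec Bool n) → BipGraph n r → BipGraph (trues S) r
    restrict S G k = G (embed S k)

    -- Rows off `S` are empty in both graphs, so `α` extends by the identity. The common domain
    -- gives the second clause of `LSLEquiv`. Classes can therefore be counted one domain at a time.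
    restrict-equivalent : ∀ S (G H : BipGraph n r) → domain G ≡ S → domain H ≡ S →
      (α : Permutation′ (trues S)) (β : Permutation′ r) →
      (∀ x y → restrict S G x y ≡ restrict S H (α ⟨$⟩ʳ x) (β ⟨$⟩ʳ y)) → LSLEquiv G H
    restrict-equivalent S G H domG domH α β eq =
      (extend S α , β , λ x y → ≡⇒⇔ (entries x y (locate S x))) ,
      λ x → mk⇔ (transfer G H domG domH x) (transfer H G domH domG x)
      where
      ≡⇒⇔ : ∀ {b c : Bool} → b ≡ c → (b ≡ true) ⇔ (c ≡ true)
      ≡⇒⇔ refl = mk⇔ (λ z → z) (λ z → z)

      entries : ∀ x y → (∃ λ k → embed S k ≡ x) ⊎ lookup S x ≡ false →
                G x y ≡ H (extend S α ⟨$⟩ʳ x) (β ⟨$⟩ʳ y)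
      entries x y (inj₁ (k , refl)) = trans (eq k y)
        (cong (λ z → H z (β ⟨$⟩ʳ y)) (sym (extendMap-inside S (α ⟨$⟩ʳ_) k)))
      entries x y (inj₂ out) =
        trans (outside-domain G x y (trans (cong (λ S → lookup S x) domG) out))
        (trans (sym (outside-domain H x (β ⟨$⟩ʳ y) (trans (cong (λ S → lookup S x) domH) out)))
               (cong (λ z → H z (β ⟨$⟩ʳ y)) (sym (extendMap-outside S (α ⟨$⟩ʳ_) x out))))

      transfer : ∀ G H → domain G ≡ S → domain H ≡ S → ∀ x → InConnDomain G x → InConnDomain H x
      transfer G H domG domH x c = true-domain H x
        (trans (cong (λ S → lookup S x) (trans domH (sym domG))) (domain-true G x c))

  -- Summation over the connected domains

  subsets : ∀ n → List (Vec Bool n)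
  subsets n = elems (finVec finBool n)

  _≟ˢ_ : ∀ {n} (S T : Vec Bool n) → Dec (S ≡ T)
  _≟ˢ_ {n} = Finite._≟_ (finVec finBool n)

  module _ {n r} (L : List (BipGraph n r))
           (distinct : ∀ (i j : Fin (length L)) → LSLEquiv (lookupᴸ L i) (lookupᴸ L j) → i ≡ j) where

    withDomain : Vec Bool n → ℕ
    withDomain S = ∑ (fins (length L)) (λ a → ind (domain (lookupᴸ L a) ≟ˢ S))

    withDomain≤quota : ∀ S → withDomain S ≤ quota r (trues S)
    withDomain≤quota S = ≤-quota (trues S) r (withDomain S)
      (Burnside.burnside (trues S) r (finFin (length L)) (λ a → domain (lookupᴸ L a) ≟ˢ S)
        (λ a → restrict S (lookupᴸ L a))
        λ a b da db α β eq → distinct a b (restrict-equivalent S _ _ da db α β eq))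
      -- The same graphs transposed: rows and columns change places, and with them `α` and `β`.
      (Burnside.burnside r (trues S) (finFin (length L)) (λ a → domain (lookupᴸ L a) ≟ˢ S)
        (λ a → flip (restrict S (lookupᴸ L a)))
        λ a b da db β α eq → distinct a b (restrict-equivalent S _ _ da db α β λ x y → eq y x))

    length≤∑quota : length L ≤ ∑ (subsets n) (λ S → quota r (trues S))
    length≤∑quota = begin
      length L
        ≡⟨ trans (∑-fins-const (length L) 1) (*-identityʳ _) ⟨
      ∑ (fins (length L)) (λ a → 1)
        ≤⟨ ∑-mono (fins (length L)) (λ a → ≤-trans
             (≤-reflexive (sym (ind-yes (domain (lookupᴸ L a) ≟ˢ domain (lookupᴸ L a)) refl)))
             (Finite.∑-≥ (finVec finBool n) (domain (lookupᴸ L a)) (λ S → ind (domain (lookupᴸ L a) ≟ˢ S)))) ⟩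
      ∑ (fins (length L)) (λ a → ∑ (subsets n) (λ S → ind (domain (lookupᴸ L a) ≟ˢ S)))
        ≡⟨ ∑-swap (fins (length L)) (subsets n) _ ⟩
      ∑ (subsets n) withDomain
        ≤⟨ ∑-mono (subsets n) withDomain≤quota ⟩
      ∑ (subsets n) (λ S → quota r (trues S)) ∎
      where open ≤-Reasoning

  ∑< : ℕ → (ℕ → ℕ) → ℕ
  ∑< zero    f = 0
  ∑< (suc k) f = f k + ∑< k f

  ∑<-cong : ∀ k {f g} → (∀ i → f i ≡ g i) → ∑< k f ≡ ∑< k g
  ∑<-cong zero    eq = refl
  ∑<-cong (suc k) eq = cong₂ _+_ (eq k) (∑<-cong k eq)

  ∑<-+ : ∀ k f g → ∑< k (λ i → f i + g i) ≡ ∑< k f + ∑< k g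
  ∑<-+ zero    f g = refl
  ∑<-+ (suc k) f g rewrite ∑<-+ k f g = +-interchange (f k) (g k) (∑< k f) (∑< k g)

  ∑<-split : ∀ a k f → ∑< (a + k) f ≡ ∑< a f + ∑< k (λ i → f (a + i))
  ∑<-split a zero    f = trans (cong (λ m → ∑< m f) (+-identityʳ a)) (sym (+-identityʳ _))
  ∑<-split a (suc k) f = trans (cong (λ m → ∑< m f) (+-suc a k))
    (trans (cong (f (a + k) +_) (∑<-split a k f)) (swap (f (a + k)) (∑< a f) _))
    where
    swap : ∀ x y z → x + (y + z) ≡ y + (x + z)
    swap = solve-∀

  ∑<-shift : ∀ k f → ∑< (suc k) f ≡ f 0 + ∑< k (f ∘ suc)
  ∑<-shift k f = trans (∑<-split 1 k f) (cong (_+ ∑< k (f ∘ suc)) (+-identityʳ (f 0)))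

  ∑<-mono : ∀ {k l} f → k ≤ l → ∑< k f ≤ ∑< l f
  ∑<-mono {k} {l} f k≤l = ≤-trans (m≤m+n _ _)
    (≤-reflexive (trans (sym (∑<-split k (l ∸ k) f)) (cong (λ m → ∑< m f) (m+[n∸m]≡n k≤l))))

  -- Subsets without and with the first element are combined by Pascal's rule.
  ∑-subsets : ∀ n (F : ℕ → ℕ) → ∑ (subsets n) (λ S → F (trues S)) ≡ ∑< (suc n) (λ i → (n C i) * F i)
  ∑-subsets zero    F = sym (cong (_+ 0) (+-identityʳ (F 0)))
  ∑-subsets (suc n) F = begin
    ∑ (subsets (suc n)) (λ S → F (trues S))
      ≡⟨ ∑-cartesian _∷_ (false ∷ true ∷ []) (subsets n) _ ⟩
    ∑ (subsets n) (λ S → F (trues S)) + (∑ (subsets n) (λ S → F (suc (trues S))) + 0)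
      ≡⟨ cong₂ (λ x y → x + (y + 0)) (∑-subsets n F) (∑-subsets n (F ∘ suc)) ⟩
    ∑< (suc n) (λ i → (n C i) * F i) + (U + 0)
      ≡⟨ cong (_+ (U + 0)) overshoot ⟨
    ∑< (suc (suc n)) (λ i → (n C i) * F i) + (U + 0)
      ≡⟨ cong (_+ (U + 0)) (∑<-shift (suc n) (λ i → (n C i) * F i)) ⟩
    F₀ + V + (U + 0)
      ≡⟨ rearrange F₀ V U ⟩
    F₀ + (U + V)
      ≡⟨ cong (F₀ +_) (∑<-+ (suc n) (λ i → (n C i) * F (suc i)) (λ i → (n C suc i) * F (suc i))) ⟨
    F₀ + ∑< (suc n) (λ i → (n C i) * F (suc i) + (n C suc i) * F (suc i))
      ≡⟨ cong (F₀ +_) (∑<-cong (suc n) pascal) ⟩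
    F₀ + ∑< (suc n) (λ i → (suc n C suc i) * F (suc i))
      ≡⟨ ∑<-shift (suc n) (λ i → (suc n C i) * F i) ⟨
    ∑< (suc (suc n)) (λ i → (suc n C i) * F i) ∎
    where
    open ≡-Reasoning
    F₀ = (n C 0) * F 0
    U = ∑< (suc n) (λ i → (n C i) * F (suc i))
    V = ∑< (suc n) (λ i → (n C suc i) * F (suc i))
    rearrange : ∀ x v u → x + v + (u + 0) ≡ x + (u + v)
    rearrange = solve-∀
    -- Adding the vanishing term i = n + 1 gives both sums of Pascal's rule the same range after the
    -- shift.
    overshoot : ∑< (suc (suc n)) (λ i → (n C i) * F i) ≡ ∑< (suc n) (λ i → (n C i) * F i)
    overshoot = cong (λ c → c * F (suc n) + ∑< (suc n) (λ i → (n C i) * F i)) (k>n⇒nCk≡0 {n} {suc n} ≤-refl)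
    pascal : ∀ i → (n C i) * F (suc i) + (n C suc i) * F (suc i) ≡ (suc n C suc i) * F (suc i)
    pascal i = trans (sym (*-distribʳ-+ (F (suc i)) (n C i) (n C suc i)))
                     (cong (_* F (suc i)) (nCk+nC[k+1]≡[n+1]C[k+1] n i))

-- Passage to the rational bound

open OrbitCounting
open import Data.Nat using (ℕ; zero; suc; _+_; _*_; _∸_; _!; _<_; z≤n; s≤s; _≥_; NonZero)
import Data.Nat as ℕ
import Data.Nat.Properties as ℕ
open import Data.Nat.Combinatorics using (_C_)
open import Data.Nat.Tactic.RingSolver using (solve-∀)
open import Data.Integer using (+_)
import Data.Integer as ℤ
import Data.Integer.Properties as ℤ
open import Data.Rational using (ℚ; _/_; _≤_; 0ℚ; toℚᵘ; fromℚᵘ) renaming (_+_ to _+ℚ_)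
import Data.Rational.Properties as ℚ
open import Data.Rational.Unnormalised as ℚᵘ using (mkℚᵘ; *≤*; *≡*)
import Data.Rational.Unnormalised.Properties as ℚᵘ

/1-homo-+ : ∀ a b → (+ (a + b)) / 1 ≡ (+ a) / 1 +ℚ (+ b) / 1
/1-homo-+ a b = ℚ.toℚᵘ-injective (begin-equality
  toℚᵘ (fromℚᵘ (mkℚᵘ (+ (a + b)) 0))
    ≃⟨ ℚ.toℚᵘ-fromℚᵘ (mkℚᵘ (+ (a + b)) 0) ⟩
  mkℚᵘ (+ (a + b)) 0
    ≃⟨ *≡* (cong (λ z → z ℤ.* + 1) (sym (cong₂ ℤ._+_ (ℤ.*-identityʳ (+ a)) (ℤ.*-identityʳ (+ b))))) ⟩
  mkℚᵘ (+ a) 0 ℚᵘ.+ mkℚᵘ (+ b) 0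
    ≃⟨ ℚᵘ.+-cong (ℚ.toℚᵘ-fromℚᵘ (mkℚᵘ (+ a) 0)) (ℚ.toℚᵘ-fromℚᵘ (mkℚᵘ (+ b) 0)) ⟨
  toℚᵘ ((+ a) / 1) ℚᵘ.+ toℚᵘ ((+ b) / 1)
    ≃⟨ ℚ.toℚᵘ-homo-+ ((+ a) / 1) ((+ b) / 1) ⟨
  toℚᵘ ((+ a) / 1 +ℚ (+ b) / 1) ∎)
  where open ℚᵘ.≤-Reasoning

/1-≤-/ : ∀ m a d .{{_ : NonZero d}} → m * d ℕ.≤ a → (+ m) / 1 ≤ (+ a) / d
/1-≤-/ m a (suc d) m*d≤a = ℚ.toℚᵘ-cancel-≤ (begin
  toℚᵘ (fromℚᵘ (mkℚᵘ (+ m) 0))   ≃⟨ ℚ.toℚᵘ-fromℚᵘ (mkℚᵘ (+ m) 0) ⟩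
  mkℚᵘ (+ m) 0                   ≤⟨ *≤* cross ⟩
  mkℚᵘ (+ a) d                   ≃⟨ ℚ.toℚᵘ-fromℚᵘ (mkℚᵘ (+ a) d) ⟨
  toℚᵘ (fromℚᵘ (mkℚᵘ (+ a) d))   ∎)
  where
  open ℚᵘ.≤-Reasoning
  cross : + m ℤ.* + suc d ℤ.≤ + a ℤ.* + 1
  cross rewrite ℤ.*-identityʳ (+ a) | sym (ℤ.pos-* m (suc d)) = ℤ.+≤+ m*d≤a

/1-mono-≤ : ∀ {a b} → a ℕ.≤ b → (+ a) / 1 ≤ (+ b) / 1
/1-mono-≤ {a} {b} a≤b = /1-≤-/ a b 1 (ℕ.≤-trans (ℕ.≤-reflexive (ℕ.*-identityʳ a)) a≤b)

-- Compares a summand in ℕ with one of `bound`: `c` is a binomial coefficient and `x` a rounded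
-- quota, which the exact fraction dominates.
divFact-lower : ∀ c x y k → x * k ! ℕ.≤ 2 * y → (+ (c * x)) / 1 ≤ divFact (2 * (c * y)) k
divFact-lower c x y k x*k!≤ = /1-≤-/ (c * x) (2 * (c * y)) (k !) {{ℕ._!≢0 k}} (begin
  c * x * k !      ≡⟨ ℕ.*-assoc c x (k !) ⟩
  c * (x * k !)    ≤⟨ ℕ.*-monoʳ-≤ c x*k!≤ ⟩
  c * (2 * y)      ≡⟨ shuffle c y ⟩
  2 * (c * y)      ∎)
  where
  open ℕ.≤-Reasoning
  shuffle : ∀ c y → c * (2 * y) ≡ 2 * (c * y)
  shuffle = solve-∀

-- The partial sums `s` enter only through their recursion equations, which `sumLoop` satisfies by
-- computation.
∑<-lower : ∀ (t : ℕ → ℕ) (f s : ℕ → ℚ) → s 0 ≡ 0ℚ → (∀ k → s (suc k) ≡ f k +ℚ s k) →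
           ∀ K → (∀ k → k < K → (+ t k) / 1 ≤ f k) → (+ ∑< K t) / 1 ≤ s K
∑<-lower t f s s₀ s₊ zero    t≤f = ℚ.≤-reflexive (sym s₀)
∑<-lower t f s s₀ s₊ (suc K) t≤f = begin
  (+ (t K + ∑< K t)) / 1            ≡⟨ /1-homo-+ (t K) (∑< K t) ⟩
  (+ t K) / 1 +ℚ (+ ∑< K t) / 1     ≤⟨ ℚ.+-mono-≤ (t≤f K ℕ.≤-refl)
                                        (∑<-lower t f s s₀ s₊ K λ k k<K → t≤f k (ℕ.m≤n⇒m≤1+n k<K)) ⟩
  f K +ℚ s K                        ≡⟨ s₊ K ⟨
  s (suc K)                         ∎
  where open ℚ.≤-Reasoning

-- The loop inside sumFromTo has no name outside Defs; unification recovers it once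
-- its iteration count is abstracted.
mutual
  sumLoop : ℕ → ℕ → (ℕ → ℚ) → ℕ → ℚ
  sumLoop a b f k = _

  sumFromTo-loop : ∀ a b f → sumFromTo a b f ≡ sumLoop a b f (suc b ∸ a)
  sumFromTo-loop a b f with suc b ∸ a
  ... | K = refl

sumFromTo-lower : ∀ a b (t : ℕ → ℕ) f → (∀ k → k < suc b ∸ a → (+ t (a + k)) / 1 ≤ f (a + k)) →
                  (+ ∑< (suc b ∸ a) (λ k → t (a + k))) / 1 ≤ sumFromTo a b f
sumFromTo-lower a b t f t≤f = subst (_ ≤_) (sym (sumFromTo-loop a b f))
  (∑<-lower (λ k → t (a + k)) (λ k → f (a + k)) (sumLoop a b f) refl (λ _ → refl) (suc b ∸ a) t≤f)

theorem4 : (n r : ℕ) → n ≥ 2 → r ≥ 2 →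
    (L : List (BipGraph n r)) → IsClassRepList L →
    ((+ (length L)) / 1) ≤ bound n r
theorem4 n r@(suc r-1) _ _ L (_ , distinct) = begin
  (+ length L) / 1
    ≤⟨ /1-mono-≤ length≤ ⟩
  (+ (1 + low + t r + high)) / 1
    ≡⟨ trans (/1-homo-+ (1 + low + t r) high)
      (cong (_+ℚ (+ high) / 1) (trans (/1-homo-+ (1 + low) (t r))
        (cong (_+ℚ (+ t r) / 1) (/1-homo-+ 1 low)))) ⟩
  (+ 1) / 1 +ℚ (+ low) / 1 +ℚ (+ t r) / 1 +ℚ (+ high) / 1
    ≤⟨ ℚ.+-mono-≤ (ℚ.+-mono-≤ (ℚ.+-monoʳ-≤ ((+ 1) / 1)
         (sumFromTo-lower 1 r-1 t _ λ k k<r-1 →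
           divFact-lower (n C suc k) (quota r (suc k)) _ (suc k) (quota-wide (suc k) r (s≤s z≤n) (s≤s k<r-1))))
         (divFact-lower (n C r) (quota r r) _ r (quota-square r (s≤s z≤n))))
         (sumFromTo-lower (r + 1) n t _ λ k _ →
           divFact-lower (n C (r + 1 + k)) (quota r (r + 1 + k)) _ r
             (quota-tall (r + 1 + k) r (ℕ.≤-trans (ℕ.≤-reflexive (ℕ.+-comm 1 r)) (ℕ.m≤m+n (r + 1) k)))) ⟩
  bound n r ∎
  where
  open ℚ.≤-Reasoning
  t : ℕ → ℕ
  t i = (n C i) * quota r i
  low  = ∑< r-1 (t ∘ suc)
  high = ∑< (suc n ∸ (r + 1)) (λ k → t (r + 1 + k))

  swap : ∀ x y → x + (1 + y) ≡ 1 + y + x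
  swap = solve-∀

  length≤ : length L ℕ.≤ 1 + low + t r + high
  length≤ = ℕ.≤-trans (length≤∑quota L distinct)
    (ℕ.≤-trans (ℕ.≤-reflexive (∑-subsets n (quota r)))
    -- The range is replaced by one of length (r + 1) + (n + 1 ∸ (r + 1)), which covers 0, ..., n
    -- even when n < r, so that the terms up to `r` can always be split off.
    (ℕ.≤-trans (∑<-mono t (ℕ.m≤n+m∸n (suc n) (r + 1)))
    (ℕ.≤-reflexive (trans (∑<-split (r + 1) (suc n ∸ (r + 1)) t)
      (cong (_+ high) (trans (cong (λ m → ∑< m t) (ℕ.+-comm r 1))
        -- `t 0` computes to 1: the empty domain supplies the leading 1 of `bound`.
        (trans (cong (λ z → t r + z) (∑<-shift r-1 t)) (swap (t r) low))))))))
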